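{- For every $r>1$ there exists a constant $C_r>0$ depending only on $r$ such that the following holds. Let $(a_n)_{n\in\mathbb{N}}$ be an increasing sequence of positive integers which is lacunary with growth factor $r$. Then there exists $\alpha\in\mathbb{R}$ such that for all sufficiently large $N\in\mathbb{N}$ $$G(\{\alpha a_n\}_{n\le N})\le C_r\,\frac{\log N}{N}.$$
   Context: A sequence $(a_n)_{n\in\mathbb{N}}$ is lacunary with growth factor $r>1$ if $a_{n+1}\ge r a_n$ for every $n\in\mathbb{N}$. Maximal gap: for a finite family of real numbers $z_1,\dots,z_m$ ($m\ge1$), reduce each $z_i$ modulo $1$ to a representative in $[0,1)$ and sort these representatives as $0\le y_1\le y_2\le\dots\le y_m<1$; put $y_{m+1}:=1+y_1$. Then $G(\{z_i\}_{i\le m}):=\max_{2\le k\le m+1}(y_k-y_{k-1})$ is the largest gap between neighbouring points on the unit torus. Thus $G(\{\alpha a_n\}_{n\le N})$ is the maximal gap of the points $\alpha a_1,\dots,\alpha a_N$ modulo $1$. -}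

module Defs where

open import Data.Nat as ℕ using (ℕ; zero; suc)
import Data.Nat.Properties as ℕₚ
open import Data.Integer as ℤ using (ℤ; +_)
import Data.Integer.Properties as ℤₚ
open import Data.Rational as ℚ using (ℚ; 0ℚ; 1ℚ; ½; mkℚ; ∣_∣)
import Data.Rational.Properties as ℚₚ
import Data.Rational.Unnormalised as ℚᵘ
import Data.Rational.Unnormalised.Properties as ℚᵘₚ
open import Data.Nat.Coprimality using (1-coprimeTo)
import Data.Integer.Solver as ℤ-Solver
open import Data.Rational.Solver using (module +-*-Solver)
open import Data.Fin as Fin using (Fin; zero; suc; inject₁; punchOut)
import Data.Fin.Properties as Finₚ
import Data.Fin.Permutation as Perm
open import Data.Fin.Permutation using (Permutation′; _⟨$⟩ʳ_)
open import Data.Vec.Functional using (Vector; insertAt)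
import Data.Vec.Functional.Properties as Vecₚ
open import Data.Product using (∃; _×_; _,_; proj₁; proj₂)
open import Data.Sum using (_⊎_; inj₁; inj₂)
open import Function using (case_of_)
open import Relation.Nullary using (¬_; yes; no; contradiction)
open import Relation.Binary.PropositionalEquality

------------------------------------------------------------------------
-- Inequalities between rationals

private

  2*½ : ∀ ε → ½ ℚ.* ε ℚ.+ ½ ℚ.* ε ≡ ε
  2*½ = solve 1 (λ e → con ½ :* e :+ con ½ :* e := e) refl
    where open +-*-Solver

  ½-pos : ∀ {ε} → 0ℚ ℚ.< ε → 0ℚ ℚ.< ½ ℚ.* ε
  ½-pos {ε} p = subst (ℚ._< ½ ℚ.* ε) (ℚₚ.*-zeroʳ ½) (ℚₚ.*-monoʳ-<-pos ½ p)

  x≤∣x∣ : ∀ x → x ℚ.≤ ∣ x ∣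
  x≤∣x∣ x with ℚₚ.≤-total 0ℚ x
  ... | inj₁ p = ℚₚ.≤-reflexive (sym (ℚₚ.0≤p⇒∣p∣≡p p))
  ... | inj₂ p = ℚₚ.≤-trans p (ℚₚ.0≤∣p∣ x)

  ∣x-y∣-sym : ∀ x y → ∣ x ℚ.- y ∣ ≡ ∣ y ℚ.- x ∣
  ∣x-y∣-sym x y = trans (sym (ℚₚ.∣-p∣≡∣p∣ (x ℚ.- y)))
    (cong ∣_∣ (solve 2 (λ a b → :- (a :- b) := b :- a) refl x y))
    where open +-*-Solver

  ∣x∣≤ : ∀ {x e} → x ℚ.≤ e → ℚ.- x ℚ.≤ e → ∣ x ∣ ℚ.≤ e
  ∣x∣≤ {x} {e} p q with ℚₚ.∣p∣≡p∨∣p∣≡-p x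
  ... | inj₁ r = subst (ℚ._≤ e) (sym r) p
  ... | inj₂ r = subst (ℚ._≤ e) (sym r) q

  ≤+to- : ∀ {x y e} → x ℚ.≤ y ℚ.+ e → x ℚ.- y ℚ.≤ e
  ≤+to- {x} {y} {e} p = subst (x ℚ.- y ℚ.≤_)
    (solve 2 (λ b c → b :+ c :- b := c) refl y e) (ℚₚ.+-monoˡ-≤ (ℚ.- y) p)
    where open +-*-Solver

  -to≤+ : ∀ {x y e} → x ℚ.- y ℚ.≤ e → x ℚ.≤ y ℚ.+ e
  -to≤+ {x} {y} {e} p = subst (ℚ._≤ y ℚ.+ e)
    (solve 2 (λ a b → b :+ (a :- b) := a) refl x y) (ℚₚ.+-monoʳ-≤ y p)
    where open +-*-Solver

  ∣x-y∣≤⇒x≤y+ : ∀ x y {e} → ∣ x ℚ.- y ∣ ℚ.≤ e → x ℚ.≤ y ℚ.+ e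
  ∣x-y∣≤⇒x≤y+ x y p = -to≤+ (ℚₚ.≤-trans (x≤∣x∣ _) p)

  ≤⇒∣x-y∣≤ : ∀ {x y e} → x ℚ.≤ y ℚ.+ e → y ℚ.≤ x ℚ.+ e → ∣ x ℚ.- y ∣ ℚ.≤ e
  ≤⇒∣x-y∣≤ {x} {y} {e} p q = ∣x∣≤ (≤+to- p)
    (subst (ℚ._≤ e) (solve 2 (λ a b → b :- a := :- (a :- b)) refl x y) (≤+to- q))
    where open +-*-Solver

  +-mono-½ : ∀ {x y} ε → x ℚ.≤ ½ ℚ.* ε → y ℚ.≤ ½ ℚ.* ε → x ℚ.+ y ℚ.≤ ε
  +-mono-½ {x} {y} ε p q = subst (x ℚ.+ y ℚ.≤_) (2*½ ε) (ℚₚ.+-mono-≤ p q)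

------------------------------------------------------------------------
-- Real numbers: Cauchy sequences of rationals, considered up to _≃_.  Moduli are
-- existential, so the arithmetic operations act termwise.

IsCauchy : (ℕ → ℚ) → Set
IsCauchy x = ∀ ε → 0ℚ ℚ.< ε →
  ∃ λ K → ∀ m n → K ℕ.≤ m → K ℕ.≤ n → ∣ x m ℚ.- x n ∣ ℚ.≤ ε

record ℝ : Set where
  constructor mkℝ
  field
    seq    : ℕ → ℚ
    cauchy : IsCauchy seq

open ℝ public

infix 4 _≃_ _≤_ _<_ _≈₁_

record _≃_ (x y : ℝ) : Set where
  constructor mk≃
  field
    ≃-within : ∀ ε → 0ℚ ℚ.< ε →
      ∃ λ K → ∀ n → K ℕ.≤ n → ∣ seq x n ℚ.- seq y n ∣ ℚ.≤ ε

record _≤_ (x y : ℝ) : Set where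
  constructor mk≤
  field
    ≤-within : ∀ ε → 0ℚ ℚ.< ε →
      ∃ λ K → ∀ n → K ℕ.≤ n → seq x n ℚ.≤ seq y n ℚ.+ ε

record _<_ (x y : ℝ) : Set where
  constructor mk<
  field
    <-apart : ∃ λ ε → 0ℚ ℚ.< ε ×
      ∃ λ K → ∀ n → K ℕ.≤ n → seq x n ℚ.+ ε ℚ.≤ seq y n

open _≃_ public
open _≤_ public
open _<_ public

private abstract

  const-cauchy : ∀ q → IsCauchy (λ _ → q)
  const-cauchy q ε ε>0 =
    0 , λ _ _ _ _ → subst (ℚ._≤ ε) (cong ∣_∣ (sym (ℚₚ.+-inverseʳ q))) (ℚₚ.<⇒≤ ε>0)

fromℚ : ℚ → ℝ
fromℚ q = mkℝ (λ _ → q) (const-cauchy q)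

fromℤ : ℤ → ℝ
fromℤ k = fromℚ (k ℚ./ 1)

fromℕ : ℕ → ℝ
fromℕ n = fromℤ (+ n)

0ℝ 1ℝ : ℝ
0ℝ = fromℚ 0ℚ
1ℝ = fromℚ 1ℚ

infixl 6 _+_ _-_
infixl 6 _⊔_
infixl 7 _*_
infix  8 -_

private abstract

  +-cauchy : ∀ x y → IsCauchy x → IsCauchy y → IsCauchy (λ n → x n ℚ.+ y n)
  +-cauchy x y cx cy ε ε>0 =
    let K , p = cx (½ ℚ.* ε) (½-pos ε>0)
        L , q = cy (½ ℚ.* ε) (½-pos ε>0)
    in K ℕ.⊔ L , λ m n Km Kn → begin
      ∣ x m ℚ.+ y m ℚ.- (x n ℚ.+ y n) ∣
        ≡⟨ cong ∣_∣ (solve 4 (λ a b c d → a :+ b :- (c :+ d) := a :- c :+ (b :- d))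
             refl (x m) (y m) (x n) (y n)) ⟩
      ∣ x m ℚ.- x n ℚ.+ (y m ℚ.- y n) ∣
        ≤⟨ ℚₚ.∣p+q∣≤∣p∣+∣q∣ (x m ℚ.- x n) (y m ℚ.- y n) ⟩
      ∣ x m ℚ.- x n ∣ ℚ.+ ∣ y m ℚ.- y n ∣
        ≤⟨ +-mono-½ ε
             (p m n (ℕₚ.m⊔n≤o⇒m≤o K L Km) (ℕₚ.m⊔n≤o⇒m≤o K L Kn))
             (q m n (ℕₚ.m⊔n≤o⇒n≤o K L Km) (ℕₚ.m⊔n≤o⇒n≤o K L Kn)) ⟩
      ε ∎
    where open ℚₚ.≤-Reasoning
          open +-*-Solver

  neg-cauchy : ∀ x → IsCauchy x → IsCauchy (λ n → ℚ.- x n)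
  neg-cauchy x cx ε ε>0 =
    let K , p = cx ε ε>0
    in K , λ m n Km Kn → subst (ℚ._≤ ε)
         (trans (∣x-y∣-sym (x m) (x n))
           (cong ∣_∣ (solve 2 (λ a b → b :- a := :- a :- :- b) refl (x m) (x n))))
         (p m n Km Kn)
    where open +-*-Solver

  ⊔-cauchy : ∀ x y → IsCauchy x → IsCauchy y → IsCauchy (λ n → x n ℚ.⊔ y n)
  ⊔-cauchy x y cx cy ε ε>0 =
    let K , p = cx ε ε>0
        L , q = cy ε ε>0
        bound : ∀ m n → K ℕ.⊔ L ℕ.≤ m → K ℕ.⊔ L ℕ.≤ n →
                x m ℚ.⊔ y m ℚ.≤ x n ℚ.⊔ y n ℚ.+ ε
        bound m n Km Kn = ℚₚ.⊔-lub {x n ℚ.⊔ y n ℚ.+ ε} {x m} {y m}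
          (ℚₚ.≤-trans
            (∣x-y∣≤⇒x≤y+ (x m) (x n) (p m n (ℕₚ.m⊔n≤o⇒m≤o K L Km) (ℕₚ.m⊔n≤o⇒m≤o K L Kn)))
            (ℚₚ.+-monoˡ-≤ ε {_} {x n ℚ.⊔ y n} (ℚₚ.p≤p⊔q (x n) (y n))))
          (ℚₚ.≤-trans
            (∣x-y∣≤⇒x≤y+ (y m) (y n) (q m n (ℕₚ.m⊔n≤o⇒n≤o K L Km) (ℕₚ.m⊔n≤o⇒n≤o K L Kn)))
            (ℚₚ.+-monoˡ-≤ ε {_} {x n ℚ.⊔ y n} (ℚₚ.p≤q⊔p (x n) (y n))))
    in K ℕ.⊔ L , λ m n Km Kn → ≤⇒∣x-y∣≤ (bound m n Km Kn) (bound n m Kn Km)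

  cauchy-bounded : ∀ x → IsCauchy x →
    ∃ λ B → 0ℚ ℚ.< B × ∃ λ K → ∀ n → K ℕ.≤ n → ∣ x n ∣ ℚ.≤ B
  cauchy-bounded x cx =
    let K , p = cx 1ℚ (ℚₚ.positive⁻¹ 1ℚ)
    in ∣ x K ∣ ℚ.+ 1ℚ
     , ℚₚ.+-mono-≤-< (ℚₚ.0≤∣p∣ (x K)) (ℚₚ.positive⁻¹ 1ℚ)
     , K
     , λ n Kn → begin
         ∣ x n ∣
           ≡⟨ cong ∣_∣ (solve 2 (λ a b → a := b :+ (a :- b)) refl (x n) (x K)) ⟩
         ∣ x K ℚ.+ (x n ℚ.- x K) ∣
           ≤⟨ ℚₚ.∣p+q∣≤∣p∣+∣q∣ (x K) (x n ℚ.- x K) ⟩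
         ∣ x K ∣ ℚ.+ ∣ x n ℚ.- x K ∣
           ≤⟨ ℚₚ.+-monoʳ-≤ ∣ x K ∣ (p n K Kn ℕₚ.≤-refl) ⟩
         ∣ x K ∣ ℚ.+ 1ℚ ∎
    where open ℚₚ.≤-Reasoning
          open +-*-Solver

  scale-cauchy : ∀ x → IsCauchy x → ∀ B → 0ℚ ℚ.< B → ∀ ε → 0ℚ ℚ.< ε →
    ∃ λ K → ∀ m n → K ℕ.≤ m → K ℕ.≤ n → B ℚ.* ∣ x m ℚ.- x n ∣ ℚ.≤ ε
  scale-cauchy x cx B B>0 ε ε>0 =
    let K , p = cx δ δ>0
    in K , λ m n Km Kn → ℚₚ.≤-trans
         (ℚₚ.*-monoˡ-≤-nonNeg B {{ℚₚ.pos⇒nonNeg B}} (p m n Km Kn))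
         (ℚₚ.≤-reflexive Bδ≡ε)
    where
      instance
        B-pos : ℚ.Positive B
        B-pos = ℚ.positive B>0
        B-nz : ℚ.NonZero B
        B-nz = ℚₚ.pos⇒nonZero B
      δ : ℚ
      δ = ℚ.1/ B ℚ.* ε
      δ>0 : 0ℚ ℚ.< δ
      δ>0 = subst (ℚ._< δ) (ℚₚ.*-zeroʳ (ℚ.1/ B)) (ℚₚ.*-monoʳ-<-pos (ℚ.1/ B) {{ℚₚ.1/pos⇒pos B}} ε>0)
      Bδ≡ε : B ℚ.* δ ≡ ε
      Bδ≡ε = trans (sym (ℚₚ.*-assoc B (ℚ.1/ B) ε))
        (trans (cong (ℚ._* ε) (ℚₚ.*-inverseʳ B)) (ℚₚ.*-identityˡ ε))

  *-cauchy : ∀ x y → IsCauchy x → IsCauchy y → IsCauchy (λ n → x n ℚ.* y n)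
  *-cauchy x y cx cy ε ε>0 =
    let A , A>0 , K₁ , a = cauchy-bounded x cx
        B , B>0 , K₂ , b = cauchy-bounded y cy
        K₃ , p = scale-cauchy x cx B B>0 (½ ℚ.* ε) (½-pos ε>0)
        K₄ , q = scale-cauchy y cy A A>0 (½ ℚ.* ε) (½-pos ε>0)
        K = (K₁ ℕ.⊔ K₂) ℕ.⊔ (K₃ ℕ.⊔ K₄)
        k₁ : ∀ {m} → K ℕ.≤ m → K₁ ℕ.≤ m
        k₁ h = ℕₚ.m⊔n≤o⇒m≤o K₁ K₂ (ℕₚ.m⊔n≤o⇒m≤o (K₁ ℕ.⊔ K₂) (K₃ ℕ.⊔ K₄) h)
        k₂ : ∀ {m} → K ℕ.≤ m → K₂ ℕ.≤ m
        k₂ h = ℕₚ.m⊔n≤o⇒n≤o K₁ K₂ (ℕₚ.m⊔n≤o⇒m≤o (K₁ ℕ.⊔ K₂) (K₃ ℕ.⊔ K₄) h)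
        k₃ : ∀ {m} → K ℕ.≤ m → K₃ ℕ.≤ m
        k₃ h = ℕₚ.m⊔n≤o⇒m≤o K₃ K₄ (ℕₚ.m⊔n≤o⇒n≤o (K₁ ℕ.⊔ K₂) (K₃ ℕ.⊔ K₄) h)
        k₄ : ∀ {m} → K ℕ.≤ m → K₄ ℕ.≤ m
        k₄ h = ℕₚ.m⊔n≤o⇒n≤o K₃ K₄ (ℕₚ.m⊔n≤o⇒n≤o (K₁ ℕ.⊔ K₂) (K₃ ℕ.⊔ K₄) h)
    in K , λ m n Km Kn → begin
      ∣ x m ℚ.* y m ℚ.- x n ℚ.* y n ∣
        ≡⟨ cong ∣_∣ (solve 4 (λ a b c d → a :* b :- c :* d := (a :- c) :* d :+ a :* (b :- d))
             refl (x m) (y m) (x n) (y n)) ⟩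
      ∣ (x m ℚ.- x n) ℚ.* y n ℚ.+ x m ℚ.* (y m ℚ.- y n) ∣
        ≤⟨ ℚₚ.∣p+q∣≤∣p∣+∣q∣ ((x m ℚ.- x n) ℚ.* y n) (x m ℚ.* (y m ℚ.- y n)) ⟩
      ∣ (x m ℚ.- x n) ℚ.* y n ∣ ℚ.+ ∣ x m ℚ.* (y m ℚ.- y n) ∣
        ≡⟨ cong₂ ℚ._+_
             (trans (ℚₚ.∣p*q∣≡∣p∣*∣q∣ (x m ℚ.- x n) (y n))
                    (ℚₚ.*-comm ∣ x m ℚ.- x n ∣ ∣ y n ∣))
             (ℚₚ.∣p*q∣≡∣p∣*∣q∣ (x m) (y m ℚ.- y n)) ⟩
      ∣ y n ∣ ℚ.* ∣ x m ℚ.- x n ∣ ℚ.+ ∣ x m ∣ ℚ.* ∣ y m ℚ.- y n ∣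
        ≤⟨ +-mono-½ ε
             (ℚₚ.≤-trans
               (ℚₚ.*-monoʳ-≤-nonNeg ∣ x m ℚ.- x n ∣ {{ℚₚ.∣-∣-nonNeg (x m ℚ.- x n)}}
                 (b n (k₂ Kn)))
               (p m n (k₃ Km) (k₃ Kn)))
             (ℚₚ.≤-trans
               (ℚₚ.*-monoʳ-≤-nonNeg ∣ y m ℚ.- y n ∣ {{ℚₚ.∣-∣-nonNeg (y m ℚ.- y n)}}
                 (a m (k₁ Km)))
               (q m n (k₄ Km) (k₄ Kn))) ⟩
      ε ∎
    where open ℚₚ.≤-Reasoning
          open +-*-Solver

_+_ : ℝ → ℝ → ℝ
mkℝ x cx + mkℝ y cy = mkℝ (λ n → x n ℚ.+ y n) (+-cauchy x y cx cy)

-_ : ℝ → ℝ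
- mkℝ x cx = mkℝ (λ n → ℚ.- x n) (neg-cauchy x cx)

_-_ : ℝ → ℝ → ℝ
x - y = x + - y

_*_ : ℝ → ℝ → ℝ
mkℝ x cx * mkℝ y cy = mkℝ (λ n → x n ℚ.* y n) (*-cauchy x y cx cy)

_⊔_ : ℝ → ℝ → ℝ
mkℝ x cx ⊔ mkℝ y cy = mkℝ (λ n → x n ℚ.⊔ y n) (⊔-cauchy x y cx cy)

infixl 7 _/ℕ_

_/ℕ_ : ℝ → (n : ℕ) → .{{_ : ℕ.NonZero n}} → ℝ
x /ℕ n = x * fromℚ (+ 1 ℚ./ n)

------------------------------------------------------------------------
-- The natural logarithm of a positive integer

1/suc : ℕ → ℚ
1/suc k = mkℚ (+ 1) k (1-coprimeTo (suc k))

-- 1/(k+1) + 1/(k+2) + ⋯ + 1/(k+c)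
harmonicBlock : ℕ → ℕ → ℚ
harmonicBlock k zero    = 0ℚ
harmonicBlock k (suc c) = 1/suc k ℚ.+ harmonicBlock (suc k) c

-- log N = ∫₁ᴺ dt/t.  With M = m + 1, the right Riemann sum of mesh 1/M is
--   Σ_{i=1}^{(N-1)M} (1/M) · 1/(1 + i/M) = Σ_{i=1}^{(N-1)M} 1/(M + i).
logSum : ℕ → ℕ → ℚ
logSum N m = harmonicBlock (suc m) ((N ℕ.∸ 1) ℕ.* suc m)

private

  1/-mono : ∀ {k l} → k ℕ.≤ l → 1/suc l ℚ.≤ 1/suc k
  1/-mono k≤l = ℚ.*≤* (ℤ.+≤+ (ℕₚ.+-monoˡ-≤ 0 (ℕ.s≤s k≤l)))

  1/-nonNeg : ∀ k → 0ℚ ℚ.≤ 1/suc k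
  1/-nonNeg k = ℚₚ.nonNegative⁻¹ (1/suc k)

  infixr 8 _·_
  _·_ : ℕ → ℚ → ℚ
  zero  · u = 0ℚ
  suc n · u = u ℚ.+ n · u

  ·-mono : ∀ n {u v} → u ℚ.≤ v → n · u ℚ.≤ n · v
  ·-mono zero    p = ℚₚ.≤-refl
  ·-mono (suc n) p = ℚₚ.+-mono-≤ p (·-mono n p)

  toℚᵘ-· : ∀ n k → ℚ.toℚᵘ (n · (1/suc k)) ℚᵘ.≃ + n ℚᵘ./ suc k
  toℚᵘ-· zero    k = ℚᵘ.*≡* refl
  toℚᵘ-· (suc n) k = ℚᵘₚ.≃-trans
    (ℚₚ.toℚᵘ-homo-+ (1/suc k) (n · (1/suc k)))
    (ℚᵘₚ.≃-trans (ℚᵘₚ.+-congʳ (+ 1 ℚᵘ./ suc k) (toℚᵘ-· n k))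
      (ℚᵘ.*≡* (solve 2 (λ a d → (con (+ 1) :* d :+ a :* d) :* d
                              := (con (+ 1) :+ a) :* (d :* d)) refl (+ n) (+ suc k))))
    where open ℤ-Solver.+-*-Solver

  ·-1/ : ∀ n m → suc n · (1/suc (m ℕ.+ n ℕ.* suc m)) ≡ 1/suc m
  ·-1/ n m = ℚₚ.toℚᵘ-injective (ℚᵘₚ.≃-trans (toℚᵘ-· (suc n) (m ℕ.+ n ℕ.* suc m))
    (ℚᵘ.*≡* (trans (sym (ℤₚ.pos-* (suc n) (suc m)))
                   (sym (ℤₚ.*-identityˡ (+ (suc n ℕ.* suc m)))))))

  block-++ : ∀ k c d → harmonicBlock k (c ℕ.+ d) ≡ harmonicBlock k c ℚ.+ harmonicBlock (c ℕ.+ k) d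
  block-++ k zero    d = sym (ℚₚ.+-identityˡ (harmonicBlock k d))
  block-++ k (suc c) d = trans
    (cong (1/suc k ℚ.+_) (trans (block-++ (suc k) c d)
      (cong (λ j → harmonicBlock (suc k) c ℚ.+ harmonicBlock j d) (ℕₚ.+-suc c k))))
    (sym (ℚₚ.+-assoc (1/suc k) (harmonicBlock (suc k) c) _))

  block-upper : ∀ k l c → k ℕ.≤ l → harmonicBlock l c ℚ.≤ c · (1/suc k)
  block-upper k l zero    k≤l = ℚₚ.≤-refl
  block-upper k l (suc c) k≤l =
    ℚₚ.+-mono-≤ (1/-mono k≤l) (block-upper k (suc l) c (ℕₚ.m≤n⇒m≤1+n k≤l))

  block-lower : ∀ k l c → l ℕ.+ c ℕ.≤ suc k → c · (1/suc k) ℚ.≤ harmonicBlock l c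
  block-lower k l zero    h = ℚₚ.≤-refl
  block-lower k l (suc c) h =
    let h′ = subst (ℕ._≤ suc k) (ℕₚ.+-suc l c) h
    in ℚₚ.+-mono-≤ (1/-mono (ℕₚ.≤-trans (ℕₚ.m≤m+n l c) (ℕ.s≤s⁻¹ h′))) (block-lower k (suc l) c h′)

  -- With N = n + 1 and M = m + 1, both sides are H_{N(M+1)} − H_M.
  logSum-step : ∀ n m → 1/suc (suc m) ℚ.+ logSum (suc n) (suc m)
                      ≡ logSum (suc n) m ℚ.+ harmonicBlock (suc n ℕ.* suc m) (suc n)
  logSum-step n m = trans
    (cong (harmonicBlock (suc m)) lengths)
    (trans (block-++ (suc m) (n ℕ.* suc m) (suc n))
      (cong (λ j → logSum (suc n) m ℚ.+ harmonicBlock j (suc n)) (ℕₚ.+-comm (n ℕ.* suc m) (suc m))))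
    where
      lengths : suc (n ℕ.* suc (suc m)) ≡ n ℕ.* suc m ℕ.+ suc n
      lengths = trans (cong suc (trans (ℕₚ.*-suc n (suc m)) (ℕₚ.+-comm n (n ℕ.* suc m))))
        (sym (ℕₚ.+-suc (n ℕ.* suc m) n))

  logSum-mono : ∀ n m → logSum (suc n) m ℚ.≤ logSum (suc n) (suc m)
  logSum-mono n m = +-cancelˡ-≤ (1/suc (suc m)) (begin
    1/suc (suc m) ℚ.+ logSum (suc n) m
      ≡⟨ cong (ℚ._+ logSum (suc n) m) (·-1/ n (suc m)) ⟨
    suc n · (1/suc (suc m ℕ.+ n ℕ.* suc (suc m))) ℚ.+ logSum (suc n) m
      ≤⟨ ℚₚ.+-monoˡ-≤ (logSum (suc n) m)
           (block-lower _ (suc n ℕ.* suc m) (suc n)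
             (ℕₚ.≤-reflexive (sym (trans (ℕₚ.*-suc (suc n) (suc m))
               (ℕₚ.+-comm (suc n) (suc n ℕ.* suc m)))))) ⟩
    harmonicBlock (suc n ℕ.* suc m) (suc n) ℚ.+ logSum (suc n) m
      ≡⟨ ℚₚ.+-comm (harmonicBlock (suc n ℕ.* suc m) (suc n)) (logSum (suc n) m) ⟩
    logSum (suc n) m ℚ.+ harmonicBlock (suc n ℕ.* suc m) (suc n)
      ≡⟨ logSum-step n m ⟨
    1/suc (suc m) ℚ.+ logSum (suc n) (suc m) ∎)
    where
      open ℚₚ.≤-Reasoning
      +-cancelˡ-≤ : ∀ r {p q} → r ℚ.+ p ℚ.≤ r ℚ.+ q → p ℚ.≤ q
      +-cancelˡ-≤ r {p} {q} h = subst₂ ℚ._≤_ (e p) (e q) (ℚₚ.+-monoʳ-≤ (ℚ.- r) h)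
        where
          open +-*-Solver
          e : ∀ x → ℚ.- r ℚ.+ (r ℚ.+ x) ≡ x
          e x = solve 2 (λ a b → :- a :+ (a :+ b) := b) refl r x

  logSum+1/-anti : ∀ n m → logSum (suc n) (suc m) ℚ.+ 1/suc (suc m)
                         ℚ.≤ logSum (suc n) m ℚ.+ 1/suc m
  logSum+1/-anti n m = begin
    logSum (suc n) (suc m) ℚ.+ 1/suc (suc m)
      ≡⟨ trans (ℚₚ.+-comm (logSum (suc n) (suc m)) _) (logSum-step n m) ⟩
    logSum (suc n) m ℚ.+ harmonicBlock (suc n ℕ.* suc m) (suc n)
      ≤⟨ ℚₚ.+-monoʳ-≤ (logSum (suc n) m)
           (block-upper (m ℕ.+ n ℕ.* suc m) (suc n ℕ.* suc m) (suc n) (ℕₚ.n≤1+n _)) ⟩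
    logSum (suc n) m ℚ.+ suc n · (1/suc (m ℕ.+ n ℕ.* suc m))
      ≡⟨ cong (logSum (suc n) m ℚ.+_) (·-1/ n m) ⟩
    logSum (suc n) m ℚ.+ 1/suc m ∎
    where open ℚₚ.≤-Reasoning

  logSum-close : ∀ n m d → logSum (suc n) m ℚ.≤ logSum (suc n) (d ℕ.+ m)
                         × logSum (suc n) (d ℕ.+ m) ℚ.+ 1/suc (d ℕ.+ m)
                           ℚ.≤ logSum (suc n) m ℚ.+ 1/suc m
  logSum-close n m zero    = ℚₚ.≤-refl , ℚₚ.≤-refl
  logSum-close n m (suc d) =
    let p , q = logSum-close n m d
    in ℚₚ.≤-trans p (logSum-mono n (d ℕ.+ m))
     , ℚₚ.≤-trans (logSum+1/-anti n (d ℕ.+ m)) q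

  archimedean : ∀ ε → 0ℚ ℚ.< ε → ∃ λ K → 1/suc K ℚ.≤ ε
  archimedean (mkℚ (+ suc n) d c) _ = 
    d , ℚ.*≤* (ℤ.+≤+ (ℕₚ.*-monoˡ-≤ (suc d) (ℕ.s≤s (ℕ.z≤n {n}))))
  archimedean (mkℚ (+ 0) d c) (ℚ.*<* (ℤ.+<+ ()))
  archimedean (mkℚ ℤ.-[1+ n ] d c) (ℚ.*<* ())

private abstract

  logSum-cauchy : ∀ N → IsCauchy (logSum N)
  logSum-cauchy zero ε ε>0 = 0 , λ _ _ _ _ → ℚₚ.<⇒≤ ε>0
  logSum-cauchy (suc n) ε ε>0 =
    let K , 1/K≤ε = archimedean ε ε>0 in
    K , λ m l Km Kl → ≤⇒∣x-y∣≤
      (ℚₚ.≤-trans (one K 1/K≤ε m Km) (ℚₚ.+-monoˡ-≤ ε (two K l Kl)))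
      (ℚₚ.≤-trans (one K 1/K≤ε l Kl) (ℚₚ.+-monoˡ-≤ ε (two K m Km)))
    where
      two : ∀ K m → K ℕ.≤ m → logSum (suc n) K ℚ.≤ logSum (suc n) m
      two K m Km = subst (λ j → logSum (suc n) K ℚ.≤ logSum (suc n) j) (ℕₚ.m∸n+n≡m Km)
        (proj₁ (logSum-close n K (m ℕ.∸ K)))
      one : ∀ K → 1/suc K ℚ.≤ ε → ∀ m → K ℕ.≤ m →
            logSum (suc n) m ℚ.≤ logSum (suc n) K ℚ.+ ε
      one K h m Km = begin
        logSum (suc n) m                           ≡⟨ ℚₚ.+-identityʳ _ ⟨
        logSum (suc n) m ℚ.+ 0ℚ                    ≤⟨ ℚₚ.+-monoʳ-≤ (logSum (suc n) m) (1/-nonNeg m) ⟩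
        logSum (suc n) m ℚ.+ 1/suc m         ≤⟨ three ⟩
        logSum (suc n) K ℚ.+ 1/suc K         ≤⟨ ℚₚ.+-monoʳ-≤ (logSum (suc n) K) h ⟩
        logSum (suc n) K ℚ.+ ε                     ∎
        where
          open ℚₚ.≤-Reasoning
          three : logSum (suc n) m ℚ.+ 1/suc m ℚ.≤ logSum (suc n) K ℚ.+ 1/suc K
          three = subst (λ j → logSum (suc n) j ℚ.+ 1/suc j ℚ.≤ logSum (suc n) K ℚ.+ 1/suc K)
            (ℕₚ.m∸n+n≡m Km) (proj₂ (logSum-close n K (m ℕ.∸ K)))

log : (N : ℕ) → .{{_ : ℕ.NonZero N}} → ℝ
log N = mkℝ (logSum N) (logSum-cauchy N)

------------------------------------------------------------------------
-- The maximal gap modulo 1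

-- Congruence modulo 1.
_≈₁_ : ℝ → ℝ → Set
x ≈₁ y = ∃ λ (k : ℤ) → x ≃ y + fromℤ k

record IsSortedMod1 {m : ℕ} (z y : Vector ℝ m) : Set where
  field
    reorder : Permutation′ m
    reduced : ∀ i → y i ≈₁ z (reorder ⟨$⟩ʳ i)
    lower   : ∀ i → 0ℝ ≤ y i
    upper   : ∀ i → y i < 1ℝ
    sorted  : ∀ i j → i Fin.≤ j → y i ≤ y j

max : ∀ {n} → Vector ℝ (suc n) → ℝ
max {zero}  v = v zero
max {suc n} v = v zero ⊔ max (λ i → v (suc i))

-- y₁ , … , yₘ , 1 + y₁
wrap : ∀ {n} → Vector ℝ (suc n) → Vector ℝ (suc (suc n))
wrap {n} y = insertAt y (Fin.fromℕ (suc n)) (1ℝ + y zero)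

largestGap : ∀ {m} → .{{_ : ℕ.NonZero m}} → Vector ℝ m → ℝ
largestGap {suc n} y = max (λ k → wrap y (suc k) - wrap y (inject₁ k))

-- g = G(z₁, …, zₘ).  Reduction modulo 1 and sorting are discontinuous, so G is
-- given by its graph; it is everywhere defined classically (maximalGap-exists).
record IsMaximalGap {m : ℕ} .{{_ : ℕ.NonZero m}} (z : Vector ℝ m) (g : ℝ) : Set where
  field
    residues : Vector ℝ m
    isSorted : IsSortedMod1 z residues
    gap      : g ≃ largestGap residues

private

  bind : ∀ {A B : Set} → ¬ ¬ A → (A → ¬ ¬ B) → ¬ ¬ B
  bind p f k = p (λ a → f a k)

  ≃-refl : ∀ x → x ≃ x
  ≃-refl x = mk≃ λ ε ε>0 → 0 , λ n _ →
    subst (ℚ._≤ ε) (cong ∣_∣ (sym (ℚₚ.+-inverseʳ (seq x n)))) (ℚₚ.<⇒≤ ε>0)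

  p≤p+ε : ∀ p {ε} → 0ℚ ℚ.< ε → p ℚ.≤ p ℚ.+ ε
  p≤p+ε p {ε} ε>0 = subst (ℚ._≤ p ℚ.+ ε) (ℚₚ.+-identityʳ p) (ℚₚ.+-monoʳ-≤ p (ℚₚ.<⇒≤ ε>0))

  ≤-refl : ∀ x → x ≤ x
  ≤-refl x = mk≤ λ ε ε>0 → 0 , λ n _ → p≤p+ε (seq x n) ε>0

  ≤-trans : ∀ {x y z} → x ≤ y → y ≤ z → x ≤ z
  ≤-trans {x} {y} {z} p q = mk≤ λ ε ε>0 →
    let K , f = ≤-within p (½ ℚ.* ε) (½-pos ε>0)
        L , g = ≤-within q (½ ℚ.* ε) (½-pos ε>0)
    in K ℕ.⊔ L , λ n h → begin
      seq x n                             ≤⟨ f n (ℕₚ.m⊔n≤o⇒m≤o K L h) ⟩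
      seq y n ℚ.+ ½ ℚ.* ε                 ≤⟨ ℚₚ.+-monoˡ-≤ (½ ℚ.* ε) (g n (ℕₚ.m⊔n≤o⇒n≤o K L h)) ⟩
      seq z n ℚ.+ ½ ℚ.* ε ℚ.+ ½ ℚ.* ε     ≡⟨ ℚₚ.+-assoc (seq z n) _ _ ⟩
      seq z n ℚ.+ (½ ℚ.* ε ℚ.+ ½ ℚ.* ε)   ≡⟨ cong (seq z n ℚ.+_) (2*½ ε) ⟩
      seq z n ℚ.+ ε                       ∎
    where open ℚₚ.≤-Reasoning

  <⇒≤ : ∀ {x y} → x < y → x ≤ y
  <⇒≤ {x} {y} (mk< (δ , δ>0 , K , f)) = mk≤ λ ε ε>0 → K , λ n h →
    ℚₚ.≤-trans (p≤p+ε (seq x n) δ>0) (ℚₚ.≤-trans (f n h) (p≤p+ε (seq y n) ε>0))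

  <-≤-absurd : ∀ {x y} → x < y → ¬ (y ≤ x)
  <-≤-absurd {x} {y} (mk< (δ , δ>0 , K , f)) q =
    let L , g = ≤-within q (½ ℚ.* δ) (½-pos δ>0)
        n = K ℕ.⊔ L
        le : seq x n ℚ.+ δ ℚ.≤ seq x n ℚ.+ ½ ℚ.* δ
        le = ℚₚ.≤-trans (f n (ℕₚ.m≤m⊔n K L)) (g n (ℕₚ.m≤n⊔m K L))
        lt : seq x n ℚ.+ ½ ℚ.* δ ℚ.< seq x n ℚ.+ δ
        lt = ℚₚ.+-monoʳ-< (seq x n) (subst₂ ℚ._<_ (ℚₚ.+-identityʳ (½ ℚ.* δ)) (2*½ δ)
               (ℚₚ.+-monoʳ-< (½ ℚ.* δ) (½-pos δ>0)))
    in ℚₚ.<-irrefl refl (ℚₚ.<-≤-trans lt le)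

  ≮⇒≥ : ∀ x y → ¬ (x < y) → y ≤ x
  ≮⇒≥ x y x≮y = mk≤ λ ε ε>0 →
    let δ = ½ ℚ.* (½ ℚ.* ε)
        δ>0 = ½-pos (½-pos ε>0)
        K , p = cauchy x δ δ>0
        L , q = cauchy y δ δ>0
    in K ℕ.⊔ L , λ n h → ℚₚ.≮⇒≥ λ gap → x≮y (mk< (½ ℚ.* ε , ½-pos ε>0 , K ℕ.⊔ L , λ m h′ →
      begin
        seq x m ℚ.+ ½ ℚ.* ε
          ≤⟨ ℚₚ.+-monoˡ-≤ (½ ℚ.* ε) (∣x-y∣≤⇒x≤y+ (seq x m) (seq x n)
               (p m n (ℕₚ.m⊔n≤o⇒m≤o K L h′) (ℕₚ.m⊔n≤o⇒m≤o K L h))) ⟩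
        seq x n ℚ.+ δ ℚ.+ ½ ℚ.* ε
          ≡⟨ solve 2 (λ a e → a :+ con ½ :* (con ½ :* e) :+ con ½ :* e
                           := a :+ e :- con ½ :* (con ½ :* e)) refl (seq x n) ε ⟩
        seq x n ℚ.+ ε ℚ.- δ
          ≤⟨ ℚₚ.+-monoˡ-≤ (ℚ.- δ) (ℚₚ.<⇒≤ gap) ⟩
        seq y n ℚ.- δ
          ≤⟨ ≤+to- {seq y n} {δ} {seq y m} (subst (seq y n ℚ.≤_) (ℚₚ.+-comm (seq y m) δ)
               (∣x-y∣≤⇒x≤y+ (seq y n) (seq y m)
                 (q n m (ℕₚ.m⊔n≤o⇒n≤o K L h) (ℕₚ.m⊔n≤o⇒n≤o K L h′)))) ⟩
        seq y m ∎))
    where open ℚₚ.≤-Reasoning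
          open +-*-Solver

  <-or-≥ : ∀ x y → ¬ ¬ (x < y ⊎ y ≤ x)
  <-or-≥ x y k = k (inj₂ (≮⇒≥ x y (λ p → k (inj₁ p))))

  toℚᵘ-ℤ : ∀ k → ℚ.toℚᵘ (k ℚ./ 1) ℚᵘ.≃ k ℚᵘ./ 1
  toℚᵘ-ℤ k = ℚₚ.toℚᵘ-fromℚᵘ (k ℚᵘ./ 1)

  ℤ-homo-+ : ∀ j k → (j ℤ.+ k) ℚ./ 1 ≡ j ℚ./ 1 ℚ.+ k ℚ./ 1
  ℤ-homo-+ j k = ℚₚ.toℚᵘ-injective (begin
    ℚ.toℚᵘ ((j ℤ.+ k) ℚ./ 1)
      ≈⟨ toℚᵘ-ℤ (j ℤ.+ k) ⟩
    (j ℤ.+ k) ℚᵘ./ 1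
      ≈⟨ ℚᵘ.*≡* (cong (ℤ._* + 1) (sym (cong₂ ℤ._+_ (ℤₚ.*-identityʳ j) (ℤₚ.*-identityʳ k)))) ⟩
    j ℚᵘ./ 1 ℚᵘ.+ k ℚᵘ./ 1
      ≈⟨ ℚᵘₚ.+-cong (toℚᵘ-ℤ j) (toℚᵘ-ℤ k) ⟨
    ℚ.toℚᵘ (j ℚ./ 1) ℚᵘ.+ ℚ.toℚᵘ (k ℚ./ 1)
      ≈⟨ ℚₚ.toℚᵘ-homo-+ (j ℚ./ 1) (k ℚ./ 1) ⟨
    ℚ.toℚᵘ (j ℚ./ 1 ℚ.+ k ℚ./ 1) ∎)
    where open import Relation.Binary.Reasoning.Setoid ℚᵘₚ.≃-setoid

  ≈₁-shift : ∀ {y} x j → y ≈₁ (x + fromℤ j) → y ≈₁ x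
  ≈₁-shift {y} x j (k , mk≃ f) = j ℤ.+ k , mk≃ λ ε ε>0 →
    let K , g = f ε ε>0 in K , λ n h →
    subst (λ w → ∣ seq y n ℚ.- w ∣ ℚ.≤ ε)
      (trans (ℚₚ.+-assoc (seq x n) (j ℚ./ 1) (k ℚ./ 1))
             (cong (seq x n ℚ.+_) (sym (ℤ-homo-+ j k))))
      (g n h)

  ≈₁-refl : ∀ x → x ≈₁ x
  ≈₁-refl x = + 0 , mk≃ λ ε ε>0 → 0 , λ n _ →
    subst (ℚ._≤ ε) (cong ∣_∣ (trans (sym (ℚₚ.+-inverseʳ (seq x n)))
      (cong (λ w → seq x n ℚ.- w) (sym (ℚₚ.+-identityʳ (seq x n)))))) (ℚₚ.<⇒≤ ε>0)

  Reduced : ℝ → Set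
  Reduced x = ∃ λ y → y ≈₁ x × 0ℝ ≤ y × y < 1ℝ

  reduce-below : ∀ d x → 0ℝ ≤ x → x < fromℕ d → ¬ ¬ Reduced x
  reduce-below zero    x 0≤x x<0 _ = <-≤-absurd x<0 0≤x
  reduce-below (suc d) x 0≤x x<d = bind (<-or-≥ x 1ℝ) λ
    { (inj₁ x<1) k → k (x , ≈₁-refl x , 0≤x , x<1)
    ; (inj₂ 1≤x) → bind (reduce-below d (x + fromℤ (ℤ.- + 1)) (lower′ 1≤x) (upper′ x<d)) λ
      { (y , y≈ , b) k → k (y , ≈₁-shift x (ℤ.- + 1) y≈ , b) } }
    where
      open +-*-Solver
      lower′ : 1ℝ ≤ x → 0ℝ ≤ x + fromℤ (ℤ.- + 1)
      lower′ (mk≤ f) = mk≤ λ ε ε>0 → let K , g = f ε ε>0 in K , λ n h →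
        subst (0ℚ ℚ.≤_) (solve 2 (λ a e → a :+ e :- con 1ℚ := a :- con 1ℚ :+ e) refl (seq x n) ε)
          (ℚₚ.+-monoˡ-≤ (ℚ.- 1ℚ) (g n h))
      upper′ : x < fromℕ (suc d) → x + fromℤ (ℤ.- + 1) < fromℕ d
      upper′ (mk< (δ , δ>0 , K , g)) = mk< (δ , δ>0 , K , λ n h →
        subst₂ ℚ._≤_ (solve 2 (λ a e → a :+ e :- con 1ℚ := a :- con 1ℚ :+ e) refl (seq x n) δ)
          (trans (cong (ℚ._- 1ℚ) (ℤ-homo-+ (+ 1) (+ d)))
                 (solve 1 (λ a → con 1ℚ :+ a :- con 1ℚ := a) refl (+ d ℚ./ 1)))
          (ℚₚ.+-monoˡ-≤ (ℚ.- 1ℚ) (g n h)))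

  ∣q∣≤ : ∀ q → ∣ q ∣ ℚ.≤ + ℤ.∣ ℚ.↥ q ∣ ℚ./ 1
  ∣q∣≤ (mkℚ n d c) = ℚₚ.toℚᵘ-cancel-≤ (ℚᵘₚ.≤-trans
    (ℚᵘ.*≤* (subst₂ ℤ._≤_ (ℤₚ.pos-* ℤ.∣ n ∣ 1) (ℤₚ.pos-* ℤ.∣ n ∣ (suc d))
      (ℤ.+≤+ (ℕₚ.*-monoʳ-≤ ℤ.∣ n ∣ (ℕ.s≤s (ℕ.z≤n {d}))))))
    (ℚᵘₚ.≤-reflexive (ℚᵘₚ.≃-sym (toℚᵘ-ℤ (+ ℤ.∣ n ∣)))))

  reduce-bounded : ∀ x β b → β ≡ + b ℚ./ 1 → ∀ K → (∀ n → K ℕ.≤ n → ∣ seq x n ∣ ℚ.≤ β) → ¬ ¬ Reduced x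
  reduce-bounded x β b β≡b K f =
    bind (reduce-below (suc (b ℕ.+ b)) (x + fromℤ (+ b)) (mk≤ above) (mk< (1ℚ , ℚₚ.positive⁻¹ 1ℚ , K , below)))
      λ { (y , y≈ , r) k → k (y , ≈₁-shift x (+ b) y≈ , r) }
    where
      above : ∀ ε → 0ℚ ℚ.< ε → ∃ λ K → ∀ n → K ℕ.≤ n → 0ℚ ℚ.≤ seq x n ℚ.+ + b ℚ./ 1 ℚ.+ ε
      above ε ε>0 = K , λ n h → ℚₚ.≤-trans
        (subst₂ ℚ._≤_ (ℚₚ.+-inverseʳ (seq x n)) (cong (seq x n ℚ.+_) β≡b)
          (ℚₚ.+-monoʳ-≤ (seq x n) (ℚₚ.≤-trans (x≤∣x∣ (ℚ.- seq x n))
            (subst (ℚ._≤ β) (sym (ℚₚ.∣-p∣≡∣p∣ (seq x n))) (f n h)))))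
        (p≤p+ε (seq x n ℚ.+ + b ℚ./ 1) ε>0)
      total : β ℚ.+ β ℚ.+ 1ℚ ≡ + suc (b ℕ.+ b) ℚ./ 1
      total = trans (ℚₚ.+-comm (β ℚ.+ β) 1ℚ) (sym (trans (ℤ-homo-+ (+ 1) (+ (b ℕ.+ b)))
        (cong (1ℚ ℚ.+_) (trans (ℤ-homo-+ (+ b) (+ b)) (sym (cong₂ ℚ._+_ β≡b β≡b))))))
      below : ∀ n → K ℕ.≤ n → seq x n ℚ.+ + b ℚ./ 1 ℚ.+ 1ℚ ℚ.≤ + suc (b ℕ.+ b) ℚ./ 1
      below n h = subst₂ ℚ._≤_ (cong (λ w → seq x n ℚ.+ w ℚ.+ 1ℚ) β≡b) total
        (ℚₚ.+-monoˡ-≤ 1ℚ (ℚₚ.+-monoˡ-≤ β (ℚₚ.≤-trans (x≤∣x∣ (seq x n)) (f n h))))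

  reduce : ∀ x → ¬ ¬ Reduced x
  reduce x with cauchy-bounded (seq x) (cauchy x)
  ... | B , _ , K , f = reduce-bounded x (+ ℤ.∣ ℚ.↥ B ∣ ℚ./ 1) ℤ.∣ ℚ.↥ B ∣ refl K
    λ n h → ℚₚ.≤-trans (f n h) (ℚₚ.≤-trans (x≤∣x∣ B) (∣q∣≤ B))

  Sorted : ∀ {m} → Vector ℝ m → Set
  Sorted y = ∀ i j → i Fin.≤ j → y i ≤ y j

  insertAt-elim : ∀ (P : ℝ → Set) {m} (y : Vector ℝ m) p v →
    P v → (∀ j → P (y j)) → ∀ i → P (insertAt y p v i)
  insertAt-elim P          y zero    v Pv Py zero    = Pv
  insertAt-elim P          y zero    v Pv Py (suc i) = Py i
  insertAt-elim P {suc m}  y (suc p) v Pv Py zero    = Py zero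
  insertAt-elim P {suc m}  y (suc p) v Pv Py (suc i) =
    insertAt-elim P (λ j → y (suc j)) p v Pv (λ j → Py (suc j)) i

  insert-sorted : ∀ {m} (y : Vector ℝ m) v → Sorted y → ¬ ¬ ∃ λ p → Sorted (insertAt y p v)
  insert-sorted {zero} y v s k = k (zero , λ { zero zero _ → ≤-refl v })
  insert-sorted {suc m} y v s = bind (<-or-≥ v (y zero)) λ where
    (inj₁ v<y) k → k (zero , λ where
      zero    zero    _ → ≤-refl v
      zero    (suc j) _ → ≤-trans (<⇒≤ v<y) (s zero j ℕ.z≤n)
      (suc i) (suc j) h → s i j (ℕ.s≤s⁻¹ h))
    (inj₂ y≤v) → bind (insert-sorted (λ j → y (suc j)) v (λ i j h → s (suc i) (suc j) (ℕ.s≤s h)))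
      λ { (p , s′) k → k (suc p , λ where
            zero    zero    _ → ≤-refl (y zero)
            zero    (suc j) _ → insertAt-elim (y zero ≤_) (λ j → y (suc j)) p v y≤v
                                  (λ j → s zero (suc j) ℕ.z≤n) j
            (suc i) (suc j) h → s′ i j (ℕ.s≤s⁻¹ h)) }

  reduce-all : ∀ {m} (z : Vector ℝ m) → ¬ ¬ ∃ (IsSortedMod1 z)
  reduce-all {zero} z k = k (z , record
    { reorder = Perm.id ; reduced = λ () ; lower = λ () ; upper = λ () ; sorted = λ () })
  reduce-all {suc m} z =
    bind (reduce (z zero)) λ { (v , v≈ , 0≤v , v<1) →
    bind (reduce-all (λ i → z (suc i))) λ { (y , S) →
    bind (insert-sorted y v (IsSortedMod1.sorted S)) λ { (p , s) k →
    let open IsSortedMod1 S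
        σ = Perm.insert p zero reorder
        at-p : σ ⟨$⟩ʳ p ≡ zero
        at-p = insert-at p reorder
        reduced′ : ∀ i → insertAt y p v i ≈₁ z (σ ⟨$⟩ʳ i)
        reduced′ i = case p Finₚ.≟ i of λ where
          (yes refl) → subst₂ (λ a b → a ≈₁ z b) (sym (Vecₚ.insertAt-lookup y p v)) (sym at-p) v≈
          (no p≢i) →
            let j = punchOut p≢i in
            subst (λ i → insertAt y p v i ≈₁ z (σ ⟨$⟩ʳ i)) (Finₚ.punchIn-punchOut p≢i)
              (subst₂ (λ a b → a ≈₁ z b) (sym (Vecₚ.insertAt-punchIn y p v j))
                (sym (Perm.insert-punchIn p zero reorder j)) (reduced j))
    in k (insertAt y p v , record
      { reorder = σ
      ; reduced = reduced′
      ; lower   = insertAt-elim (0ℝ ≤_) y p v 0≤v lower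
      ; upper   = insertAt-elim (_< 1ℝ) y p v v<1 upper
      ; sorted  = s }) } } }
    where
      insert-at : ∀ {m} (p : Fin (suc m)) (π : Permutation′ m) → Perm.insert p zero π ⟨$⟩ʳ p ≡ zero
      insert-at p π with p Finₚ.≟ p
      ... | yes _   = refl
      ... | no p≢p = contradiction refl p≢p

maximalGap-exists : ∀ {m} → .{{_ : ℕ.NonZero m}} → (z : Vector ℝ m) → ¬ ¬ ∃ (IsMaximalGap z)
maximalGap-exists {m} z k = reduce-all z λ { (y , S) → k (largestGap {m} y , record
  { residues = y ; isSorted = S ; gap = ≃-refl (largestGap {m} y) }) }

{-# OPTIONS --safe #-}
-- Lacunarity gives a D with a (n + D) ≥ 2 a n, so D L consecutive indices buy a factor 2^L.
-- Choose α by nested intervals: if n < n′ are consecutive chosen indices and a n′ ≥ 2^L a n,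
-- then α can be confined so that α a n mod 1 lies within 2 · 2^-L above a prescribed target,
-- whatever happens later.  Stage s prescribes the 2^s targets i/2^s with L = s + 1; stages
-- 0, …, s use only indices below D (s + 1) 2^(s+1), after which every arc [i/2^s , (i+1)/2^s]
-- contains a point and no gap exceeds 2 · 2^-s.  This is O(log N / N) for N up to the end of
-- stage s + 1, because log N ≥ (s + 1)/2 once N ≥ 2^(s+1).
module Submission where

open import Defs
open import Data.Nat as ℕ using (ℕ; zero; suc; NonZero)
import Data.Nat.Properties as ℕₚ
open import Data.Nat.Logarithm
  using (⌊log₂_⌋; ⌊log₂⌋-mono-≤; ⌊log₂[2^n]⌋≡n; ⌊log₂⌊n/2⌋⌋≡⌊log₂n⌋∸1)
open import Data.Nat.Tactic.RingSolver using (solve-∀)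
open import Data.Integer as ℤ using (ℤ; +_; +[1+_])
import Data.Integer.DivMod as ℤ÷
import Data.Integer.Properties as ℤₚ
open import Data.Rational as ℚ using (ℚ; 0ℚ; 1ℚ; ½; mkℚ; ∣_∣)
import Data.Rational.Properties as ℚₚ
open import Data.Rational.Solver using (module +-*-Solver)
import Data.Rational.Unnormalised as ℚᵘ
import Data.Rational.Unnormalised.Properties as ℚᵘₚ
open import Data.Fin as Fin using (Fin; zero; suc; toℕ; inject₁)
open import Data.Fin.Permutation using (_⟨$⟩ˡ_; inverseʳ)
import Data.Fin.Properties as Finₚ
open import Data.Fin.Relation.Unary.Top using (view; ‵fromℕ; ‵inj₁)
open import Data.Product using (Σ-syntax; ∃; ∃₂; _×_; _,_; proj₁; proj₂)
open import Data.Sum using (_⊎_; inj₁; inj₂)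
open import Data.Vec.Functional using (Vector; insertAt)
import Data.Vec.Functional.Properties as Vecₚ
open import Function using (case_of_)
open import Relation.Binary.PropositionalEquality
open import Relation.Nullary using (¬_; contradiction; yes; no)
open +-*-Solver using (solve; con; _:+_; _:*_; _:-_; :-_; _:=_)

-- Integers, powers of ½ and reciprocals as rationals

⟦_⟧ : ℤ → ℚ
⟦ k ⟧ = k ℚ./ 1

toℚᵘ-⟦⟧ : ∀ k → ℚ.toℚᵘ ⟦ k ⟧ ℚᵘ.≃ k ℚᵘ./ 1
toℚᵘ-⟦⟧ k = ℚₚ.toℚᵘ-fromℚᵘ (k ℚᵘ./ 1)

⟦⟧-+ : ∀ j k → ⟦ j ℤ.+ k ⟧ ≡ ⟦ j ⟧ ℚ.+ ⟦ k ⟧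
⟦⟧-+ j k = ℚₚ.toℚᵘ-injective (begin
  ℚ.toℚᵘ ⟦ j ℤ.+ k ⟧               ≈⟨ toℚᵘ-⟦⟧ (j ℤ.+ k) ⟩
  (j ℤ.+ k) ℚᵘ./ 1                  ≈⟨ ℚᵘ.*≡* (cong (ℤ._* + 1)
                                         (cong₂ ℤ._+_ (ℤₚ.*-identityʳ j) (ℤₚ.*-identityʳ k))) ⟨
  j ℚᵘ./ 1 ℚᵘ.+ k ℚᵘ./ 1            ≈⟨ ℚᵘₚ.+-cong (toℚᵘ-⟦⟧ j) (toℚᵘ-⟦⟧ k) ⟨
  ℚ.toℚᵘ ⟦ j ⟧ ℚᵘ.+ ℚ.toℚᵘ ⟦ k ⟧    ≈⟨ ℚₚ.toℚᵘ-homo-+ ⟦ j ⟧ ⟦ k ⟧ ⟨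
  ℚ.toℚᵘ (⟦ j ⟧ ℚ.+ ⟦ k ⟧)          ∎)
  where open import Relation.Binary.Reasoning.Setoid ℚᵘₚ.≃-setoid

⟦⟧-* : ∀ j k → ⟦ j ℤ.* k ⟧ ≡ ⟦ j ⟧ ℚ.* ⟦ k ⟧
⟦⟧-* j k = ℚₚ.toℚᵘ-injective (begin
  ℚ.toℚᵘ ⟦ j ℤ.* k ⟧               ≈⟨ toℚᵘ-⟦⟧ (j ℤ.* k) ⟩
  (j ℤ.* k) ℚᵘ./ 1                  ≈⟨ ℚᵘ.*≡* refl ⟩
  (j ℚᵘ./ 1) ℚᵘ.* (k ℚᵘ./ 1)        ≈⟨ ℚᵘₚ.*-cong (toℚᵘ-⟦⟧ j) (toℚᵘ-⟦⟧ k) ⟨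
  ℚ.toℚᵘ ⟦ j ⟧ ℚᵘ.* ℚ.toℚᵘ ⟦ k ⟧    ≈⟨ ℚₚ.toℚᵘ-homo-* ⟦ j ⟧ ⟦ k ⟧ ⟨
  ℚ.toℚᵘ (⟦ j ⟧ ℚ.* ⟦ k ⟧)          ∎)
  where open import Relation.Binary.Reasoning.Setoid ℚᵘₚ.≃-setoid

⟦⟧-neg : ∀ k → ⟦ ℤ.- k ⟧ ≡ ℚ.- ⟦ k ⟧
⟦⟧-neg k = ℚₚ.toℚᵘ-injective (begin
  ℚ.toℚᵘ ⟦ ℤ.- k ⟧     ≈⟨ toℚᵘ-⟦⟧ (ℤ.- k) ⟩
  ℚᵘ.- (k ℚᵘ./ 1)      ≈⟨ ℚᵘₚ.-‿cong (toℚᵘ-⟦⟧ k) ⟨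
  ℚᵘ.- ℚ.toℚᵘ ⟦ k ⟧    ≈⟨ ℚₚ.toℚᵘ-homo‿- ⟦ k ⟧ ⟨
  ℚ.toℚᵘ (ℚ.- ⟦ k ⟧)   ∎)
  where open import Relation.Binary.Reasoning.Setoid ℚᵘₚ.≃-setoid

⟦⟧-mono-≤ : ∀ {j k} → j ℤ.≤ k → ⟦ j ⟧ ℚ.≤ ⟦ k ⟧
⟦⟧-mono-≤ {j} {k} j≤k = ℚₚ.toℚᵘ-cancel-≤
  (ℚᵘₚ.≤-respˡ-≃ (ℚᵘₚ.≃-sym (toℚᵘ-⟦⟧ j)) (ℚᵘₚ.≤-respʳ-≃ (ℚᵘₚ.≃-sym (toℚᵘ-⟦⟧ k))
    (ℚᵘ.*≤* (ℤₚ.*-monoʳ-≤-nonNeg (+ 1) j≤k))))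

⟦⟧-cancel-≤ : ∀ {j k} → ⟦ j ⟧ ℚ.≤ ⟦ k ⟧ → j ℤ.≤ k
⟦⟧-cancel-≤ {j} {k} p
  with ℚᵘₚ.≤-respˡ-≃ (toℚᵘ-⟦⟧ j) (ℚᵘₚ.≤-respʳ-≃ (toℚᵘ-⟦⟧ k) (ℚₚ.toℚᵘ-mono-≤ p))
... | ℚᵘ.*≤* q = ℤₚ.*-cancelʳ-≤-pos j k (+ 1) q

fromℕℚ : ℕ → ℚ
fromℕℚ n = ⟦ + n ⟧

fromℕℚ-+ : ∀ m n → fromℕℚ (m ℕ.+ n) ≡ fromℕℚ m ℚ.+ fromℕℚ n
fromℕℚ-+ m n = ⟦⟧-+ (+ m) (+ n)

fromℕℚ-* : ∀ m n → fromℕℚ (m ℕ.* n) ≡ fromℕℚ m ℚ.* fromℕℚ n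
fromℕℚ-* m n = trans (cong ⟦_⟧ (ℤₚ.pos-* m n)) (⟦⟧-* (+ m) (+ n))

fromℕℚ-mono-≤ : ∀ {m n} → m ℕ.≤ n → fromℕℚ m ℚ.≤ fromℕℚ n
fromℕℚ-mono-≤ m≤n = ⟦⟧-mono-≤ (ℤ.+≤+ m≤n)

0≤fromℕℚ : ∀ n → 0ℚ ℚ.≤ fromℕℚ n
0≤fromℕℚ n = fromℕℚ-mono-≤ {0} {n} ℕ.z≤n

*-monoˡ-≤ : ∀ {p q r} → 0ℚ ℚ.≤ r → p ℚ.≤ q → r ℚ.* p ℚ.≤ r ℚ.* q
*-monoˡ-≤ {r = r} 0≤r = ℚₚ.*-monoˡ-≤-nonNeg r {{ℚ.nonNegative 0≤r}}

*-monoʳ-≤ : ∀ {p q r} → 0ℚ ℚ.≤ r → p ℚ.≤ q → p ℚ.* r ℚ.≤ q ℚ.* r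
*-monoʳ-≤ {r = r} 0≤r = ℚₚ.*-monoʳ-≤-nonNeg r {{ℚ.nonNegative 0≤r}}

½^_ : ℕ → ℚ
½^ zero  = 1ℚ
½^ suc n = ½ ℚ.* ½^ n

0≤½^ : ∀ n → 0ℚ ℚ.≤ ½^ n
0≤½^ zero    = ℚₚ.<⇒≤ (ℚₚ.positive⁻¹ 1ℚ)
0≤½^ (suc n) = subst (ℚ._≤ ½ ℚ.* ½^ n) (ℚₚ.*-zeroʳ ½) (*-monoˡ-≤ (ℚₚ.<⇒≤ (ℚₚ.positive⁻¹ ½)) (0≤½^ n))

2^*½^ : ∀ n → fromℕℚ (2 ℕ.^ n) ℚ.* ½^ n ≡ 1ℚ
2^*½^ zero    = refl
2^*½^ (suc n) = begin
  fromℕℚ (2 ℕ.* 2 ℕ.^ n) ℚ.* (½ ℚ.* ½^ n)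
    ≡⟨ cong (ℚ._* (½ ℚ.* ½^ n)) (fromℕℚ-* 2 (2 ℕ.^ n)) ⟩
  fromℕℚ 2 ℚ.* fromℕℚ (2 ℕ.^ n) ℚ.* (½ ℚ.* ½^ n)
    ≡⟨ solve 2 (λ a h → con (fromℕℚ 2) :* a :* (con ½ :* h) := a :* h) refl (fromℕℚ (2 ℕ.^ n)) (½^ n) ⟩
  fromℕℚ (2 ℕ.^ n) ℚ.* ½^ n
    ≡⟨ 2^*½^ n ⟩
  1ℚ ∎
  where open ≡-Reasoning

-- 1/n, with the junk value 1/0 = 1.
recip : ℕ → ℚ
recip n = 1/suc (ℕ.pred n)

0≤recip : ∀ n → 0ℚ ℚ.≤ recip n
0≤recip n = ℚₚ.nonNegative⁻¹ (recip n)

fromℕℚ*recip : ∀ n → .{{_ : NonZero n}} → fromℕℚ n ℚ.* recip n ≡ 1ℚ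
fromℕℚ*recip n@(suc k) = ℚₚ.toℚᵘ-injective (begin
  ℚ.toℚᵘ (fromℕℚ n ℚ.* 1/suc k)              ≈⟨ ℚₚ.toℚᵘ-homo-* (fromℕℚ n) (1/suc k) ⟩
  ℚ.toℚᵘ (fromℕℚ n) ℚᵘ.* ℚᵘ.mkℚᵘ (+ 1) k     ≈⟨ ℚᵘₚ.*-congʳ (toℚᵘ-⟦⟧ (+ n)) ⟩
  (+ n ℚᵘ./ 1) ℚᵘ.* ℚᵘ.mkℚᵘ (+ 1) k          ≈⟨ ℚᵘ.*≡* (trans (ℤₚ.*-identityʳ _)
                                                  (trans (ℤₚ.*-identityʳ (+ n)) (sym
                                                  (trans (ℤₚ.*-identityˡ _) (ℤₚ.*-identityˡ (+ n)))))) ⟩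
  ℚᵘ.1ℚᵘ ∎)
  where open import Relation.Binary.Reasoning.Setoid ℚᵘₚ.≃-setoid

1/≡recip : ∀ n → .{{_ : NonZero n}} → + 1 ℚ./ n ≡ recip n
1/≡recip (suc k) = ℚₚ.toℚᵘ-injective (ℚₚ.toℚᵘ-fromℚᵘ (ℚᵘ.mkℚᵘ (+ 1) k))

-- The equation on `m` and `q` characterises `q` as `1/m`, so the same bound serves for `recip m`
-- and for the powers `½^_`.
*-recip-≤ : ∀ {c m n q} → .{{_ : NonZero n}} → 0ℚ ℚ.≤ q → fromℕℚ m ℚ.* q ≡ 1ℚ →
            c ℕ.* m ℕ.≤ n → fromℕℚ c ℚ.* recip n ℚ.≤ q
*-recip-≤ {c} {m} {n} {q} 0≤q mq≡1 cm≤n = begin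
  fromℕℚ c ℚ.* recip n
    ≡⟨ trans (sym (ℚₚ.*-identityʳ _)) (cong (fromℕℚ c ℚ.* recip n ℚ.*_) (sym mq≡1)) ⟩
  fromℕℚ c ℚ.* recip n ℚ.* (fromℕℚ m ℚ.* q)
    ≡⟨ solve 4 (λ c r m q → c :* r :* (m :* q) := q :* ((c :* m) :* r)) refl (fromℕℚ c) (recip n) (fromℕℚ m) q ⟩
  q ℚ.* ((fromℕℚ c ℚ.* fromℕℚ m) ℚ.* recip n)
    ≡⟨ cong (λ w → q ℚ.* (w ℚ.* recip n)) (fromℕℚ-* c m) ⟨
  q ℚ.* (fromℕℚ (c ℕ.* m) ℚ.* recip n)
    ≤⟨ *-monoˡ-≤ 0≤q (*-monoʳ-≤ (0≤recip n) (fromℕℚ-mono-≤ cm≤n)) ⟩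
  q ℚ.* (fromℕℚ n ℚ.* recip n)
    ≡⟨ trans (cong (q ℚ.*_) (fromℕℚ*recip n)) (ℚₚ.*-identityʳ q) ⟩
  q ∎
  where open ℚₚ.≤-Reasoning

p≤p+q : ∀ p {q} → 0ℚ ℚ.≤ q → p ℚ.≤ p ℚ.+ q
p≤p+q p {q} 0≤q = subst (ℚ._≤ p ℚ.+ q) (ℚₚ.+-identityʳ p) (ℚₚ.+-monoʳ-≤ p 0≤q)

round-up : ∀ q → ∃ λ k → q ℚ.≤ ⟦ k ⟧ × ⟦ k ⟧ ℚ.≤ q ℚ.+ 1ℚ
-- One above the floor, not the ceiling: an integer `q` is raised by a full unit, which the bound
-- `q + 1` admits.
round-up q@(mkℚ n d-1 _) = ℤ.suc k , upper , lower
  where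
    k = n ℤ÷./ℕ suc d-1
    upper : q ℚ.≤ ⟦ ℤ.suc k ⟧
    upper = ℚₚ.toℚᵘ-cancel-≤ (ℚᵘₚ.≤-respʳ-≃ (ℚᵘₚ.≃-sym (toℚᵘ-⟦⟧ (ℤ.suc k)))
      (ℚᵘ.*≤* (subst (ℤ._≤ ℤ.suc k ℤ.* + suc d-1) (sym (ℤₚ.*-identityʳ n))
        (ℤₚ.<⇒≤ (ℤ÷.n<s[n/ℕd]*d n (suc d-1))))))
    floor-≤ : ⟦ k ⟧ ℚ.≤ q
    floor-≤ = ℚₚ.toℚᵘ-cancel-≤ (ℚᵘₚ.≤-respˡ-≃ (ℚᵘₚ.≃-sym (toℚᵘ-⟦⟧ k))
      (ℚᵘ.*≤* (subst (k ℤ.* + suc d-1 ℤ.≤_) (sym (ℤₚ.*-identityʳ n)) (ℤ÷.[n/ℕd]*d≤n n (suc d-1)))))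
    lower : ⟦ ℤ.suc k ⟧ ℚ.≤ q ℚ.+ 1ℚ
    lower = subst (ℚ._≤ q ℚ.+ 1ℚ) (trans (ℚₚ.+-comm ⟦ k ⟧ 1ℚ) (sym (⟦⟧-+ (+ 1) k)))
      (ℚₚ.+-monoˡ-≤ 1ℚ floor-≤)

archimedean : ∀ ε → 0ℚ ℚ.< ε → ∃ λ d → 1/suc d ℚ.≤ ε
archimedean (mkℚ +[1+ p ] d _) _ = d , ℚ.*≤* (ℤ.+≤+ (ℕₚ.*-monoˡ-≤ (suc d) (ℕ.s≤s (ℕ.z≤n {p}))))
archimedean (mkℚ (+ 0) d _) (ℚ.*<* 0<0) =
  contradiction 0<0 (ℤₚ.<-irrefl (sym (ℤₚ.*-zeroˡ (+ 1))))
archimedean (mkℚ ℤ.-[1+ p ] d _) (ℚ.*<* ())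

∣p-q∣≤ : ∀ p q {ε} → p ℚ.- q ℚ.≤ ε → q ℚ.- p ℚ.≤ ε → ∣ p ℚ.- q ∣ ℚ.≤ ε
∣p-q∣≤ p q {ε} h h′ with ℚₚ.∣p∣≡p∨∣p∣≡-p (p ℚ.- q)
... | inj₁ e = subst (ℚ._≤ ε) (sym e) h
... | inj₂ e = subst (ℚ._≤ ε) (trans (solve 2 (λ p q → q :- p := :- (p :- q)) refl p q) (sym e)) h′

-- Construction of α

-- An interval of length 1/Aₘ₊₁ contains an x with Aₘ₊₁ x in any prescribed residue class, so
-- [xₘ , xₘ + 2/Aₘ₊₁] has room for the choice of xₘ₊₁ and, as 2/Aₘ₊₂ ≤ 1/Aₘ₊₁, for all later ones.
module Steering (A : ℕ → ℕ) (t : ℕ → ℚ) {{A-nz : ∀ {m} → NonZero (A m)}}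
                (doubling : ∀ m → 2 ℕ.* A m ℕ.≤ A (suc m)) where

  excess : ℕ → ℚ → ℚ
  excess m q = fromℕℚ (A m) ℚ.* q ℚ.- t m

  -- `approx m` solves `A m * x = t m + winding m` exactly, and `winding (suc m)` is an integer that
  -- puts the next solution to the right of `approx m`, at a distance of at most `1/A (suc m)`.
  approx : ℕ → ℚ
  winding : ℕ → ℤ
  approx m = (t m ℚ.+ ⟦ winding m ⟧) ℚ.* recip (A m)
  winding zero    = + 0
  winding (suc m) = proj₁ (round-up (excess (suc m) (approx m)))

  A*approx : ∀ m → fromℕℚ (A m) ℚ.* approx m ≡ t m ℚ.+ ⟦ winding m ⟧
  A*approx m = begin
    fromℕℚ (A m) ℚ.* (w ℚ.* recip (A m))  ≡⟨ solve 3 (λ a w r → a :* (w :* r) := w :* (a :* r)) refl (fromℕℚ (A m)) w (recip (A m)) ⟩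
    w ℚ.* (fromℕℚ (A m) ℚ.* recip (A m))  ≡⟨ cong (w ℚ.*_) (fromℕℚ*recip (A m)) ⟩
    w ℚ.* 1ℚ                              ≡⟨ ℚₚ.*-identityʳ w ⟩
    w ∎
    where open ≡-Reasoning
          w = t m ℚ.+ ⟦ winding m ⟧

  private
    unscale : ∀ m q → (t m ℚ.+ excess m q) ℚ.* recip (A m) ≡ q
    unscale m q = begin
      (t m ℚ.+ excess m q) ℚ.* recip (A m)
        ≡⟨ solve 4 (λ t a q r → (t :+ (a :* q :- t)) :* r := q :* (a :* r)) refl (t m) (fromℕℚ (A m)) q (recip (A m)) ⟩
      q ℚ.* (fromℕℚ (A m) ℚ.* recip (A m))
        ≡⟨ trans (cong (q ℚ.*_) (fromℕℚ*recip (A m))) (ℚₚ.*-identityʳ q) ⟩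
      q ∎
      where open ≡-Reasoning

  approx-mono : ∀ m → approx m ℚ.≤ approx (suc m)
  approx-mono m = subst (ℚ._≤ approx (suc m)) (unscale (suc m) (approx m))
    (*-monoʳ-≤ (0≤recip (A (suc m))) (ℚₚ.+-monoʳ-≤ (t (suc m))
      (proj₁ (proj₂ (round-up (excess (suc m) (approx m)))))))

  approx-step : ∀ m → approx (suc m) ℚ.≤ approx m ℚ.+ recip (A (suc m))
  approx-step m = begin
    approx (suc m)
      ≤⟨ *-monoʳ-≤ (0≤recip (A (suc m))) (ℚₚ.+-monoʳ-≤ (t (suc m))
           (proj₂ (proj₂ (round-up (excess (suc m) (approx m)))))) ⟩
    (t (suc m) ℚ.+ (y ℚ.+ 1ℚ)) ℚ.* recip (A (suc m))
      ≡⟨ solve 3 (λ t y r → (t :+ (y :+ con 1ℚ)) :* r := (t :+ y) :* r :+ r) refl (t (suc m)) y (recip (A (suc m))) ⟩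
    (t (suc m) ℚ.+ y) ℚ.* recip (A (suc m)) ℚ.+ recip (A (suc m))
      ≡⟨ cong (ℚ._+ recip (A (suc m))) (unscale (suc m) (approx m)) ⟩
    approx m ℚ.+ recip (A (suc m)) ∎
    where open ℚₚ.≤-Reasoning
          y = excess (suc m) (approx m)

  ceil : ℕ → ℚ
  ceil m = approx m ℚ.+ fromℕℚ 2 ℚ.* recip (A (suc m))

  ceil-anti : ∀ m → ceil (suc m) ℚ.≤ ceil m
  ceil-anti m = begin
    approx (suc m) ℚ.+ fromℕℚ 2 ℚ.* recip (A (suc (suc m)))
      ≤⟨ ℚₚ.+-mono-≤ (approx-step m) (*-recip-≤ {2} {A (suc m)} (0≤recip (A (suc m)))
           (fromℕℚ*recip (A (suc m))) (doubling (suc m))) ⟩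
    approx m ℚ.+ r ℚ.+ r
      ≡⟨ solve 2 (λ x r → x :+ r :+ r := x :+ con (fromℕℚ 2) :* r) refl (approx m) r ⟩
    ceil m ∎
    where open ℚₚ.≤-Reasoning
          r = recip (A (suc m))

  approx-within : ∀ d m → approx m ℚ.≤ approx (d ℕ.+ m) × ceil (d ℕ.+ m) ℚ.≤ ceil m
  approx-within zero    m = ℚₚ.≤-refl , ℚₚ.≤-refl
  approx-within (suc d) m =
    let p , q = approx-within d m
    in ℚₚ.≤-trans p (approx-mono (d ℕ.+ m)) , ℚₚ.≤-trans (ceil-anti (d ℕ.+ m)) q

  approx≤ceil : ∀ m → approx m ℚ.≤ ceil m
  approx≤ceil m = p≤p+q (approx m) (subst (ℚ._≤ fromℕℚ 2 ℚ.* recip (A (suc m))) (ℚₚ.*-zeroʳ (fromℕℚ 2))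
    (*-monoˡ-≤ (0≤fromℕℚ 2) (0≤recip (A (suc m)))))

  bracket : ∀ {m n} → m ℕ.≤ n → approx m ℚ.≤ approx n × approx n ℚ.≤ ceil m
  bracket {m} {n} m≤n =
    let p , q = approx-within (n ℕ.∸ m) m
    in subst (λ j → approx m ℚ.≤ approx j × approx j ℚ.≤ ceil m) (ℕₚ.m∸n+n≡m m≤n)
         (p , ℚₚ.≤-trans (approx≤ceil _) q)

  A-unbounded : ∀ m → m ℕ.< A m
  A-unbounded zero    = ℕ.>-nonZero⁻¹ (A 0)
  A-unbounded (suc m) = ℕₚ.≤-trans (ℕₚ.+-mono-≤ (ℕₚ.≤-trans (ℕ.s≤s ℕ.z≤n) (A-unbounded m)) (A-unbounded m))
    (subst (ℕ._≤ A (suc m)) (cong (A m ℕ.+_) (ℕₚ.+-identityʳ (A m))) (doubling m))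

  width→0 : ∀ ε → 0ℚ ℚ.< ε → ∃ λ m → fromℕℚ 2 ℚ.* recip (A (suc m)) ℚ.≤ ε
  width→0 ε ε>0 =
    let d , p = archimedean ε ε>0
    -- Every value of `A` exceeds its index, so from this index on `A (suc m)` is at least
    -- `2 * suc d`.
    in 2 ℕ.* suc d , ℚₚ.≤-trans
         (*-recip-≤ {2} {suc d} (0≤recip (suc d)) (fromℕℚ*recip (suc d))
           (ℕₚ.≤-trans (ℕₚ.n≤1+n _) (ℕₚ.<⇒≤ (A-unbounded (suc (2 ℕ.* suc d)))))) p

  approx-cauchy : IsCauchy approx
  approx-cauchy ε ε>0 =
    let K , w = width→0 ε ε>0
        close : ∀ m n → K ℕ.≤ m → K ℕ.≤ n → approx m ℚ.- approx n ℚ.≤ ε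
        close m n Km Kn = begin
          approx m ℚ.- approx n    ≤⟨ ℚₚ.+-mono-≤ (proj₂ (bracket Km)) (ℚₚ.neg-antimono-≤ (proj₁ (bracket Kn))) ⟩
          ceil K ℚ.- approx K      ≡⟨ solve 2 (λ x w → x :+ w :- x := w) refl (approx K) _ ⟩
          fromℕℚ 2 ℚ.* recip (A (suc K)) ≤⟨ w ⟩
          ε ∎
    in K , λ m n Km Kn → ∣p-q∣≤ (approx m) (approx n) (close m n Km Kn) (close n m Kn Km)
    where open ℚₚ.≤-Reasoning

  α : ℝ
  α = mkℝ approx approx-cauchy

  -- Multiplied by `A m`, the interval from `approx m` to `ceil m` starts exactly at `t m` plus an
  -- integer and has length `2 * A m / A (suc m)`, at most `2 * ½^L` by the growth hypothesis. All
  -- later `approx n` lie in that interval, so the bounds hold on a tail of the sequence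
  -- representing `α`.
  α-hits : ∀ {m n L} → m ℕ.≤ n → 2 ℕ.^ L ℕ.* A m ℕ.≤ A (suc m) →
    t m ℚ.≤ approx n ℚ.* fromℕℚ (A m) ℚ.- ⟦ winding m ⟧ ×
    approx n ℚ.* fromℕℚ (A m) ℚ.- ⟦ winding m ⟧ ℚ.≤ t m ℚ.+ fromℕℚ 2 ℚ.* ½^ L
  α-hits {m} {n} {L} m≤n growth = lower , upper
    where
      open ℚₚ.≤-Reasoning
      a = fromℕℚ (A m)
      r = recip (A (suc m))
      w = ⟦ winding m ⟧
      scaled : a ℚ.* r ℚ.≤ ½^ L
      scaled = *-recip-≤ {A m} {2 ℕ.^ L} (0≤½^ L) (2^*½^ L)
        (subst (ℕ._≤ A (suc m)) (ℕₚ.*-comm (2 ℕ.^ L) (A m)) growth)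
      lower : t m ℚ.≤ approx n ℚ.* a ℚ.- w
      lower = begin
        t m                       ≡⟨ solve 2 (λ t w → t := t :+ w :- w) refl (t m) w ⟩
        t m ℚ.+ w ℚ.- w           ≡⟨ cong (ℚ._- w) (A*approx m) ⟨
        a ℚ.* approx m ℚ.- w      ≡⟨ cong (ℚ._- w) (ℚₚ.*-comm a (approx m)) ⟩
        approx m ℚ.* a ℚ.- w      ≤⟨ ℚₚ.+-monoˡ-≤ (ℚ.- w) (*-monoʳ-≤ (0≤fromℕℚ (A m)) (proj₁ (bracket m≤n))) ⟩
        approx n ℚ.* a ℚ.- w      ∎
      upper : approx n ℚ.* a ℚ.- w ℚ.≤ t m ℚ.+ fromℕℚ 2 ℚ.* ½^ L
      upper = begin
        approx n ℚ.* a ℚ.- w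
          ≤⟨ ℚₚ.+-monoˡ-≤ (ℚ.- w) (*-monoʳ-≤ (0≤fromℕℚ (A m)) (proj₂ (bracket m≤n))) ⟩
        (approx m ℚ.+ fromℕℚ 2 ℚ.* r) ℚ.* a ℚ.- w
          ≡⟨ solve 4 (λ x r a w → (x :+ con (fromℕℚ 2) :* r) :* a :- w
                               := a :* x :- w :+ con (fromℕℚ 2) :* (a :* r)) refl (approx m) r a w ⟩
        a ℚ.* approx m ℚ.- w ℚ.+ fromℕℚ 2 ℚ.* (a ℚ.* r)
          ≡⟨ cong (λ v → v ℚ.- w ℚ.+ fromℕℚ 2 ℚ.* (a ℚ.* r)) (A*approx m) ⟩
        t m ℚ.+ w ℚ.- w ℚ.+ fromℕℚ 2 ℚ.* (a ℚ.* r)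
          ≡⟨ cong (ℚ._+ fromℕℚ 2 ℚ.* (a ℚ.* r)) (solve 2 (λ t w → t :+ w :- w := t) refl (t m) w) ⟩
        t m ℚ.+ fromℕℚ 2 ℚ.* (a ℚ.* r)
          ≤⟨ ℚₚ.+-monoʳ-≤ (t m) (*-monoˡ-≤ (0≤fromℕℚ 2) scaled) ⟩
        t m ℚ.+ fromℕℚ 2 ℚ.* ½^ L ∎

-- Binary logarithms and dyadic fractions

⌊log₂⌋-unique : ∀ s {m} → 2 ℕ.^ s ℕ.≤ m → m ℕ.< 2 ℕ.^ suc s → ⌊log₂ m ⌋ ≡ s
⌊log₂⌋-unique zero    {suc zero} _ _ = refl
⌊log₂⌋-unique zero    {suc (suc m)} _ (ℕ.s≤s (ℕ.s≤s ()))
-- Halving `m` lowers the logarithm by one in truncated subtraction; `lo` makes the logarithm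
-- positive, so nothing is truncated.
⌊log₂⌋-unique (suc s) {m} lo hi = trans (sym (ℕₚ.suc-pred ⌊log₂ m ⌋ {{ℕ.>-nonZero positive}}))
  (cong suc (trans (sym (⌊log₂⌊n/2⌋⌋≡⌊log₂n⌋∸1 m)) half))
  where
    double : ∀ n → n ℕ.+ n ≡ 2 ℕ.* n
    double = solve-∀
    half : ⌊log₂ ℕ.⌊ m /2⌋ ⌋ ≡ s
    half = ⌊log₂⌋-unique s
      (subst (ℕ._≤ ℕ.⌊ m /2⌋) (sym (ℕₚ.n≡⌊n+n/2⌋ (2 ℕ.^ s)))
        (ℕₚ.⌊n/2⌋-mono (subst (ℕ._≤ m) (sym (double (2 ℕ.^ s))) lo)))
      (ℕₚ.≰⇒> λ h → ℕₚ.<⇒≱ hi (begin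
        2 ℕ.^ suc (suc s)               ≡⟨ double (2 ℕ.^ suc s) ⟨
        2 ℕ.^ suc s ℕ.+ 2 ℕ.^ suc s     ≤⟨ ℕₚ.+-mono-≤ h (ℕₚ.≤-trans h (ℕₚ.⌊n/2⌋≤⌈n/2⌉ m)) ⟩
        ℕ.⌊ m /2⌋ ℕ.+ ℕ.⌈ m /2⌉         ≡⟨ ℕₚ.⌊n/2⌋+⌈n/2⌉≡n m ⟩
        m ∎))
      where open ℕₚ.≤-Reasoning
    positive : 0 ℕ.< ⌊log₂ m ⌋
    positive = ℕₚ.≤-trans (ℕ.s≤s ℕ.z≤n)
      (subst (ℕ._≤ ⌊log₂ m ⌋) (⌊log₂[2^n]⌋≡n (suc s)) (⌊log₂⌋-mono-≤ lo))

n<2^n : ∀ n → n ℕ.< 2 ℕ.^ n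
n<2^n zero    = ℕ.s≤s ℕ.z≤n
n<2^n (suc n) = ℕₚ.+-mono-≤ (ℕₚ.m^n>0 2 n) (ℕₚ.≤-trans (n<2^n n) (ℕₚ.≤-reflexive (sym (ℕₚ.+-identityʳ _))))

-- The search descends from `N`, where `N < f (suc N)`, to the first `b` with `f b ≤ N`; the failure
-- just before it supplies the strict upper bound.
level-exists : ∀ (f : ℕ → ℕ) → (∀ s → s ℕ.< f s) → ∀ N → f 0 ℕ.≤ N → ∃ λ s → f s ℕ.≤ N × N ℕ.< f (suc s)
level-exists f f-unbounded N f0≤N = search N (ℕₚ.<-trans (ℕₚ.n<1+n N) (f-unbounded (suc N)))
  where
    search : ∀ b → N ℕ.< f (suc b) → ∃ λ s → f s ℕ.≤ N × N ℕ.< f (suc s)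
    search b h with f b ℕₚ.≤? N
    ... | yes p = b , p , h
    search zero    h | no p = contradiction f0≤N p
    search (suc b) h | no p = search b (ℕₚ.≰⇒> p)

-- Write `i = r + q * 2^s` with `0 ≤ r < 2^s`. Then `m = r + 2^s` lies in the dyadic block, and
-- division by `2^s` turns it into `i / 2^s` plus the integer `1 - q`.
dyadic-representative : ∀ s i → ∃₂ λ m c → 2 ℕ.^ s ℕ.≤ m × m ℕ.< 2 ℕ.^ suc s ×
  fromℕℚ m ℚ.* ½^ s ≡ ⟦ i ⟧ ℚ.* ½^ s ℚ.+ ⟦ c ⟧
dyadic-representative s i =
  r ℕ.+ M , + 1 ℤ.- q , ℕₚ.m≤n+m M r
  , subst (r ℕ.+ M ℕ.<_) (cong (M ℕ.+_) (sym (ℕₚ.+-identityʳ M))) (ℕₚ.+-monoˡ-< M (ℤ÷.n%ℕd<d i M))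
  , (begin
    fromℕℚ (r ℕ.+ M) ℚ.* h
      ≡⟨ cong (ℚ._* h) (fromℕℚ-+ r M) ⟩
    (fromℕℚ r ℚ.+ fromℕℚ M) ℚ.* h
      ≡⟨ solve 4 (λ r M q h → (r :+ M) :* h := (r :+ q :* M) :* h :+ (M :* h :- q :* (M :* h)))
           refl (fromℕℚ r) (fromℕℚ M) ⟦ q ⟧ h ⟩
    (fromℕℚ r ℚ.+ ⟦ q ⟧ ℚ.* fromℕℚ M) ℚ.* h ℚ.+ (fromℕℚ M ℚ.* h ℚ.- ⟦ q ⟧ ℚ.* (fromℕℚ M ℚ.* h))
      ≡⟨ cong₂ (λ x y → x ℚ.* h ℚ.+ (y ℚ.- ⟦ q ⟧ ℚ.* y)) i-split (sym (2^*½^ s)) ⟨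
    ⟦ i ⟧ ℚ.* h ℚ.+ (1ℚ ℚ.- ⟦ q ⟧ ℚ.* 1ℚ)
      ≡⟨ cong (λ x → ⟦ i ⟧ ℚ.* h ℚ.+ (1ℚ ℚ.- x)) (ℚₚ.*-identityʳ ⟦ q ⟧) ⟩
    ⟦ i ⟧ ℚ.* h ℚ.+ (1ℚ ℚ.- ⟦ q ⟧)
      ≡⟨ cong (⟦ i ⟧ ℚ.* h ℚ.+_) (trans (⟦⟧-+ (+ 1) (ℤ.- q)) (cong (1ℚ ℚ.+_) (⟦⟧-neg q))) ⟨
    ⟦ i ⟧ ℚ.* h ℚ.+ ⟦ + 1 ℤ.- q ⟧ ∎)
  where
    open ≡-Reasoning
    M = 2 ℕ.^ s
    instance
      M-nz : NonZero M
      M-nz = ℕₚ.m^n≢0 2 s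
    r = i ℤ÷.%ℕ M
    q = i ℤ÷./ℕ M
    h = ½^ s
    i-split : ⟦ i ⟧ ≡ fromℕℚ r ℚ.+ ⟦ q ⟧ ℚ.* fromℕℚ M
    i-split = trans (cong ⟦_⟧ (ℤ÷.a≡a%ℕn+[a/ℕn]*n i M))
      (trans (⟦⟧-+ (+ r) (q ℤ.* + M)) (cong (fromℕℚ r ℚ.+_) (⟦⟧-* q (+ M))))

-- The winding number and the integer between target and grid point merge into a single translate.
shift-hit : ∀ {x t e v} w c → t ≡ v ℚ.+ ⟦ c ⟧ →
  t ℚ.≤ x ℚ.- ⟦ w ⟧ × x ℚ.- ⟦ w ⟧ ℚ.≤ t ℚ.+ e →
  v ℚ.≤ x ℚ.+ ⟦ ℤ.- w ℤ.- c ⟧ × x ℚ.+ ⟦ ℤ.- w ℤ.- c ⟧ ℚ.≤ v ℚ.+ e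
shift-hit {x} {t} {e} {v} w c t≡ (below , above) =
    subst₂ ℚ._≤_ (trans (cong (ℚ._- ⟦ c ⟧) t≡) (solve 2 (λ v c → v :+ c :- c := v) refl v ⟦ c ⟧))
      shift (ℚₚ.+-monoˡ-≤ (ℚ.- ⟦ c ⟧) below)
  , subst₂ ℚ._≤_ shift
      (trans (cong (λ u → u ℚ.+ e ℚ.- ⟦ c ⟧) t≡)
        (solve 3 (λ v c e → v :+ c :+ e :- c := v :+ e) refl v ⟦ c ⟧ e))
      (ℚₚ.+-monoˡ-≤ (ℚ.- ⟦ c ⟧) above)
  where
    shift : x ℚ.- ⟦ w ⟧ ℚ.- ⟦ c ⟧ ≡ x ℚ.+ ⟦ ℤ.- w ℤ.- c ⟧
    shift = trans (ℚₚ.+-assoc x (ℚ.- ⟦ w ⟧) (ℚ.- ⟦ c ⟧)) (cong (x ℚ.+_)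
      (sym (trans (⟦⟧-+ (ℤ.- w) (ℤ.- c)) (cong₂ ℚ._+_ (⟦⟧-neg w) (⟦⟧-neg c)))))

2*½^suc : ∀ s → fromℕℚ 2 ℚ.* ½^ suc s ≡ ½^ s
2*½^suc s = solve 1 (λ h → con (fromℕℚ 2) :* (con ½ :* h) := h) refl (½^ s)

-- The chosen indices and their targets

module Schedule (a : ℕ → ℕ) (D : ℕ) {{D-nz : NonZero D}} {{a-nz : ∀ {n} → NonZero (a n)}}
                (a-mono : ∀ n → a n ℕ.≤ a (suc n))
                (growth : ∀ n → suc D ℕ.* a n ℕ.≤ D ℕ.* a (suc n)) where

  a-mono-≤ : ∀ {m n} → m ℕ.≤ n → a m ℕ.≤ a n
  a-mono-≤ {m} {n} m≤n = subst (λ k → a m ℕ.≤ a k) (ℕₚ.m∸n+n≡m m≤n) (go (n ℕ.∸ m))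
    where
      go : ∀ d → a m ℕ.≤ a (d ℕ.+ m)
      go zero    = ℕₚ.≤-refl
      go (suc d) = ℕₚ.≤-trans (go d) (a-mono (d ℕ.+ m))

  -- Bernoulli's inequality for the factor `1 + 1/D` with denominators cleared: each step adds at
  -- least `a n / D`. At `j = D` the total factor is 2.
  linear-growth : ∀ j n → (D ℕ.+ j) ℕ.* a n ℕ.≤ D ℕ.* a (j ℕ.+ n)
  linear-growth zero    n = ℕₚ.≤-reflexive (cong (ℕ._* a n) (ℕₚ.+-identityʳ D))
  linear-growth (suc j) n = begin
    (D ℕ.+ suc j) ℕ.* a n              ≡⟨ cong (ℕ._* a n) (ℕₚ.+-suc D j) ⟩
    a n ℕ.+ (D ℕ.+ j) ℕ.* a n          ≤⟨ ℕₚ.+-mono-≤ (a-mono-≤ (ℕₚ.m≤n+m n j)) (linear-growth j n) ⟩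
    a (j ℕ.+ n) ℕ.+ D ℕ.* a (j ℕ.+ n)  ≤⟨ growth (j ℕ.+ n) ⟩
    D ℕ.* a (suc j ℕ.+ n)              ∎
    where open ℕₚ.≤-Reasoning

  doubling-time : ∀ n → 2 ℕ.* a n ℕ.≤ a (D ℕ.+ n)
  doubling-time n = ℕₚ.*-cancelˡ-≤ D (subst (ℕ._≤ D ℕ.* a (D ℕ.+ n)) (rearrange D (a n)) (linear-growth D n))
    where
      rearrange : ∀ D x → (D ℕ.+ D) ℕ.* x ≡ D ℕ.* (2 ℕ.* x)
      rearrange = solve-∀

  geometric-growth : ∀ s n → 2 ℕ.^ s ℕ.* a n ℕ.≤ a (s ℕ.* D ℕ.+ n)
  geometric-growth zero    n = ℕₚ.≤-reflexive (ℕₚ.+-identityʳ (a n))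
  geometric-growth (suc s) n = begin
    2 ℕ.* 2 ℕ.^ s ℕ.* a n            ≡⟨ ℕₚ.*-assoc 2 (2 ℕ.^ s) (a n) ⟩
    2 ℕ.* (2 ℕ.^ s ℕ.* a n)          ≤⟨ ℕₚ.*-monoʳ-≤ 2 (geometric-growth s n) ⟩
    2 ℕ.* a (s ℕ.* D ℕ.+ n)          ≤⟨ doubling-time (s ℕ.* D ℕ.+ n) ⟩
    a (D ℕ.+ (s ℕ.* D ℕ.+ n))        ≡⟨ cong a (ℕₚ.+-assoc D (s ℕ.* D) n) ⟨
    a (suc s ℕ.* D ℕ.+ n)            ∎
    where open ℕₚ.≤-Reasoning

  -- Stage `s` consists of the `m` with `2^s ≤ m < 2^(s+1)`, and on it the value is the exponent
  -- `s + 1`. The initial `m = 0` belongs to no stage and also gets one bit.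
  bits : ℕ → ℕ
  bits m = suc ⌊log₂ m ⌋

  -- A closed form in place of the running sum of the spacings `bits m * D`; as `bits` is monotone,
  -- consecutive values still differ by at least that much.
  index : ℕ → ℕ
  index m = D ℕ.* (m ℕ.* bits m)

  index-gap : ∀ m → bits m ℕ.* D ℕ.+ index m ℕ.≤ index (suc m)
  index-gap m = begin
    bits m ℕ.* D ℕ.+ index m       ≡⟨ rearrange D m (bits m) ⟩
    D ℕ.* (suc m ℕ.* bits m)       ≤⟨ ℕₚ.*-monoʳ-≤ D (ℕₚ.*-monoʳ-≤ (suc m) (ℕ.s≤s (⌊log₂⌋-mono-≤ (ℕₚ.n≤1+n m)))) ⟩
    index (suc m)                  ∎
    where
      open ℕₚ.≤-Reasoning
      rearrange : ∀ D m b → b ℕ.* D ℕ.+ D ℕ.* (m ℕ.* b) ≡ D ℕ.* ((1 ℕ.+ m) ℕ.* b)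
      rearrange = solve-∀

  subsequence-growth : ∀ m → 2 ℕ.^ bits m ℕ.* a (index m) ℕ.≤ a (index (suc m))
  subsequence-growth m = ℕₚ.≤-trans (geometric-growth (bits m) (index m)) (a-mono-≤ (index-gap m))

  -- With m = 2^s + i this is i/2^s modulo 1, so a dyadic block of targets is a full grid.
  target : ℕ → ℚ
  target m = fromℕℚ m ℚ.* ½^ ⌊log₂ m ⌋

  open Steering (λ m → a (index m)) target
    (λ m → ℕₚ.≤-trans (ℕₚ.*-monoˡ-≤ (a (index m)) (ℕₚ.*-monoʳ-≤ 2 (ℕₚ.m^n>0 2 ⌊log₂ m ⌋)))
                      (subsequence-growth m))
    public using (α; approx; α-hits; winding)

  -- A strict upper bound for `index m` over all `m < 2^(s+1)`, where `bits m` is at most `s + 1`.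
  stage : ℕ → ℕ
  stage s = D ℕ.* (2 ℕ.^ suc s ℕ.* suc s)

  2^suc≤stage : ∀ s → 2 ℕ.^ suc s ℕ.≤ stage s
  2^suc≤stage s = ℕₚ.≤-trans (ℕₚ.m≤m*n (2 ℕ.^ suc s) (suc s)) (ℕₚ.m≤n*m _ D)

  stage-unbounded : ∀ s → s ℕ.< stage s
  stage-unbounded s = ℕₚ.<-≤-trans (ℕₚ.<-trans (ℕₚ.n<1+n s) (n<2^n (suc s))) (2^suc≤stage s)

  -- The error `2 * ½^(s+1)` of stage `s` equals the mesh `½^s`, so a point steered to just above
  -- the left end of a grid arc stays inside that arc. The dyadic block contains the left end of
  -- every arc modulo 1.
  hit : ∀ s i → ∃₂ λ n j → n ℕ.< stage s × ∃ λ K → ∀ k → K ℕ.≤ k →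
    ⟦ i ⟧ ℚ.* ½^ s ℚ.≤ approx k ℚ.* fromℕℚ (a n) ℚ.+ ⟦ j ⟧ ×
    approx k ℚ.* fromℕℚ (a n) ℚ.+ ⟦ j ⟧ ℚ.≤ ⟦ i ⟧ ℚ.* ½^ s ℚ.+ ½^ s
  hit s i =
    let m , c , lo , hi , grid = dyadic-representative s i
        log≡ = ⌊log₂⌋-unique s lo hi
    in index m , ℤ.- winding m ℤ.- c , early log≡ hi , m , λ k m≤k →
      shift-hit {approx k ℚ.* fromℕℚ (a (index m))} {target m} {½^ s} {⟦ i ⟧ ℚ.* ½^ s} (winding m) c
        (trans (cong (λ l → fromℕℚ m ℚ.* ½^ l) log≡) grid)
        (subst (within m k) (trans (cong (λ l → fromℕℚ 2 ℚ.* ½^ suc l) log≡) (2*½^suc s))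
          (α-hits {m} {k} {bits m} m≤k (subsequence-growth m)))
    where
      within : ℕ → ℕ → ℚ → Set
      within m k e = target m ℚ.≤ approx k ℚ.* fromℕℚ (a (index m)) ℚ.- ⟦ winding m ⟧ ×
        approx k ℚ.* fromℕℚ (a (index m)) ℚ.- ⟦ winding m ⟧ ℚ.≤ target m ℚ.+ e
      early : ∀ {m} → ⌊log₂ m ⌋ ≡ s → m ℕ.< 2 ℕ.^ suc s → index m ℕ.< stage s
      early {m} log≡ hi = ℕₚ.*-monoʳ-< D (subst (λ l → m ℕ.* suc l ℕ.< 2 ℕ.^ suc s ℕ.* suc s) (sym log≡)
        (ℕₚ.*-monoˡ-< (suc s) hi))

-- Order on ℝ

½-pos : ∀ {ε} → 0ℚ ℚ.< ε → 0ℚ ℚ.< ½ ℚ.* ε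
½-pos {ε} p = subst (ℚ._< ½ ℚ.* ε) (ℚₚ.*-zeroʳ ½) (ℚₚ.*-monoʳ-<-pos ½ p)

half+half : ∀ ε → ½ ℚ.* ε ℚ.+ ½ ℚ.* ε ≡ ε
half+half = solve 1 (λ e → con ½ :* e :+ con ½ :* e := e) refl

p-q≤e⇒p≤q+e : ∀ p q {e} → p ℚ.- q ℚ.≤ e → p ℚ.≤ q ℚ.+ e
p-q≤e⇒p≤q+e p q {e} h = subst (ℚ._≤ q ℚ.+ e)
  (solve 2 (λ p q → q :+ (p :- q) := p) refl p q) (ℚₚ.+-monoʳ-≤ q h)

∣p-q∣≤e⇒p≤q+e : ∀ p q {e} → ∣ p ℚ.- q ∣ ℚ.≤ e → p ℚ.≤ q ℚ.+ e
∣p-q∣≤e⇒p≤q+e p q h = p-q≤e⇒p≤q+e p q (ℚₚ.≤-trans (p≤∣p∣ (p ℚ.- q)) h)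
  where
    p≤∣p∣ : ∀ p → p ℚ.≤ ∣ p ∣
    p≤∣p∣ p with ℚₚ.≤-total 0ℚ p
    ... | inj₁ 0≤p = ℚₚ.≤-reflexive (sym (ℚₚ.0≤p⇒∣p∣≡p 0≤p))
    ... | inj₂ p≤0 = ℚₚ.≤-trans p≤0 (ℚₚ.0≤∣p∣ p)

∣p-q∣-sym : ∀ p q → ∣ p ℚ.- q ∣ ≡ ∣ q ℚ.- p ∣
∣p-q∣-sym p q = trans (sym (ℚₚ.∣-p∣≡∣p∣ (p ℚ.- q)))
  (cong ∣_∣ (solve 2 (λ p q → :- (p :- q) := q :- p) refl p q))

eventually-≤ : ∀ {x y} K → (∀ n → K ℕ.≤ n → seq x n ℚ.≤ seq y n) → x ≤ y
eventually-≤ {x} {y} K f = mk≤ λ ε ε>0 → K , λ n h →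
  ℚₚ.≤-trans (f n h) (p≤p+q (seq y n) (ℚₚ.<⇒≤ ε>0))

≃⇒≤ : ∀ {x y} → x ≃ y → x ≤ y
≃⇒≤ {x} {y} (mk≃ f) = mk≤ λ ε ε>0 → let K , g = f ε ε>0 in K , λ n h →
  ∣p-q∣≤e⇒p≤q+e (seq x n) (seq y n) (g n h)

≃-sym : ∀ {x y} → x ≃ y → y ≃ x
≃-sym {x} {y} (mk≃ f) = mk≃ λ ε ε>0 → let K , g = f ε ε>0 in K , λ n h →
  subst (ℚ._≤ ε) (∣p-q∣-sym (seq x n) (seq y n)) (g n h)

≤-trans : ∀ {x y z} → x ≤ y → y ≤ z → x ≤ z
≤-trans {x} {y} {z} (mk≤ f) (mk≤ g) = mk≤ λ ε ε>0 →
  let K , p = f (½ ℚ.* ε) (½-pos ε>0)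
      L , q = g (½ ℚ.* ε) (½-pos ε>0)
  in K ℕ.⊔ L , λ n h → begin
    seq x n                            ≤⟨ p n (ℕₚ.m⊔n≤o⇒m≤o K L h) ⟩
    seq y n ℚ.+ ½ ℚ.* ε                ≤⟨ ℚₚ.+-monoˡ-≤ (½ ℚ.* ε) (q n (ℕₚ.m⊔n≤o⇒n≤o K L h)) ⟩
    seq z n ℚ.+ ½ ℚ.* ε ℚ.+ ½ ℚ.* ε    ≡⟨ ℚₚ.+-assoc (seq z n) (½ ℚ.* ε) (½ ℚ.* ε) ⟩
    seq z n ℚ.+ (½ ℚ.* ε ℚ.+ ½ ℚ.* ε)  ≡⟨ cong (seq z n ℚ.+_) (half+half ε) ⟩
    seq z n ℚ.+ ε                      ∎
  where open ℚₚ.≤-Reasoning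

+-mono-≤ : ∀ {x y z w} → x ≤ y → z ≤ w → x + z ≤ y + w
+-mono-≤ {x} {y} {z} {w} (mk≤ f) (mk≤ g) = mk≤ λ ε ε>0 →
  let K , p = f (½ ℚ.* ε) (½-pos ε>0)
      L , q = g (½ ℚ.* ε) (½-pos ε>0)
  in K ℕ.⊔ L , λ n h → begin
    seq x n ℚ.+ seq z n
      ≤⟨ ℚₚ.+-mono-≤ (p n (ℕₚ.m⊔n≤o⇒m≤o K L h)) (q n (ℕₚ.m⊔n≤o⇒n≤o K L h)) ⟩
    (seq y n ℚ.+ ½ ℚ.* ε) ℚ.+ (seq w n ℚ.+ ½ ℚ.* ε)
      ≡⟨ solve 3 (λ y w e → (y :+ con ½ :* e) :+ (w :+ con ½ :* e) := (y :+ w) :+ e) refl (seq y n) (seq w n) ε ⟩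
    seq y n ℚ.+ seq w n ℚ.+ ε ∎
  where open ℚₚ.≤-Reasoning

≤-refl : ∀ {x} → x ≤ x
≤-refl {x} = eventually-≤ {x} {x} 0 λ _ _ → ℚₚ.≤-refl

<⇒≤ : ∀ {x y} → x < y → x ≤ y
<⇒≤ {x} {y} (mk< (δ , δ>0 , K , f)) = eventually-≤ {x} {y} K λ n h →
  ℚₚ.≤-trans (p≤p+q (seq x n) (ℚₚ.<⇒≤ δ>0)) (f n h)

<⇒≱ : ∀ {x y} → x < y → ¬ (y ≤ x)
<⇒≱ {x} {y} (mk< (δ , δ>0 , K , f)) (mk≤ g) =
  let L , h = g (½ ℚ.* δ) (½-pos δ>0)
      n = K ℕ.⊔ L
  in ℚₚ.<-irrefl refl (begin-strict
    seq x n ℚ.+ ½ ℚ.* δ                    ≡⟨ ℚₚ.+-identityʳ _ ⟨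
    seq x n ℚ.+ ½ ℚ.* δ ℚ.+ 0ℚ             <⟨ ℚₚ.+-monoʳ-< (seq x n ℚ.+ ½ ℚ.* δ) (½-pos δ>0) ⟩
    seq x n ℚ.+ ½ ℚ.* δ ℚ.+ ½ ℚ.* δ        ≡⟨ ℚₚ.+-assoc (seq x n) (½ ℚ.* δ) (½ ℚ.* δ) ⟩
    seq x n ℚ.+ (½ ℚ.* δ ℚ.+ ½ ℚ.* δ)      ≡⟨ cong (seq x n ℚ.+_) (half+half δ) ⟩
    seq x n ℚ.+ δ                          ≤⟨ f n (ℕₚ.m≤m⊔n K L) ⟩
    seq y n                                ≤⟨ h n (ℕₚ.m≤n⊔m K L) ⟩
    seq x n ℚ.+ ½ ℚ.* δ                    ∎)
  where open ℚₚ.≤-Reasoning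

⊔-lub : ∀ {x y z} → x ≤ z → y ≤ z → x ⊔ y ≤ z
⊔-lub {x} {y} {z} (mk≤ f) (mk≤ g) = mk≤ λ ε ε>0 →
  let K , p = f ε ε>0
      L , q = g ε ε>0
  in K ℕ.⊔ L , λ n h → ℚₚ.⊔-lub (p n (ℕₚ.m⊔n≤o⇒m≤o K L h)) (q n (ℕₚ.m⊔n≤o⇒n≤o K L h))

max-lub : ∀ {n} (v : Vector ℝ (suc n)) {b} → (∀ i → v i ≤ b) → max v ≤ b
max-lub {zero}  v {b} h = h zero
max-lub {suc n} v {b} h = ⊔-lub {v zero} {max (λ i → v (suc i))} {b} (h zero) (max-lub (λ i → v (suc i)) {b} (λ i → h (suc i)))

rational-upper-bound : ∀ x ε → 0ℚ ℚ.< ε → ∃ λ q → x < fromℚ q × fromℚ q ≤ x + fromℚ ε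
rational-upper-bound x ε ε>0 =
  let δ = ½ ℚ.* (½ ℚ.* ε)
      δ>0 = ½-pos (½-pos ε>0)
      K , f = cauchy x δ δ>0
      -- The tail of `x` stays within `ε/4` of `seq x K`: adding `ε/2` leaves a margin of `ε/4`
      -- above `x` and overshoots it by at most `3ε/4`.
      q = seq x K ℚ.+ ½ ℚ.* ε
  in q
   , mk< (δ , δ>0 , K , λ n h → begin
       seq x n ℚ.+ δ
         ≤⟨ ℚₚ.+-monoˡ-≤ δ (∣p-q∣≤e⇒p≤q+e (seq x n) (seq x K) (f n K h ℕₚ.≤-refl)) ⟩
       seq x K ℚ.+ δ ℚ.+ δ
         ≡⟨ trans (ℚₚ.+-assoc (seq x K) δ δ) (cong (seq x K ℚ.+_) (half+half (½ ℚ.* ε))) ⟩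
       q ∎)
   , eventually-≤ {fromℚ q} {x + fromℚ ε} K λ n h → begin
       seq x K ℚ.+ ½ ℚ.* ε
         ≤⟨ ℚₚ.+-monoˡ-≤ (½ ℚ.* ε) (∣p-q∣≤e⇒p≤q+e (seq x K) (seq x n) (f K n ℕₚ.≤-refl h)) ⟩
       seq x n ℚ.+ δ ℚ.+ ½ ℚ.* ε
         ≤⟨ p≤p+q _ (ℚₚ.<⇒≤ δ>0) ⟩
       seq x n ℚ.+ δ ℚ.+ ½ ℚ.* ε ℚ.+ δ
         ≡⟨ solve 2 (λ x e → x :+ con ½ :* (con ½ :* e) :+ con ½ :* e :+ con ½ :* (con ½ :* e) := x :+ e) refl (seq x n) ε ⟩
       seq x n ℚ.+ ε ∎
  where open ℚₚ.≤-Reasoning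

-- Rounding is available for rationals but not for reals, so the left end `u` of a gap is replaced
-- by rationals `q` above it, which may be taken arbitrarily close to `u`.
difference-≤ : ∀ u v c → (∀ q → u < fromℚ q → v ≤ fromℚ (q ℚ.+ c)) → v - u ≤ fromℚ c
difference-≤ u v c f = mk≤ λ ε ε>0 →
  let q , u<q , q≤ = rational-upper-bound u (½ ℚ.* (½ ℚ.* ε)) (½-pos (½-pos ε>0))
      K , g = ≤-within (f q u<q) (½ ℚ.* ε) (½-pos ε>0)
      L , h = ≤-within q≤ (½ ℚ.* (½ ℚ.* ε)) (½-pos (½-pos ε>0))
  in K ℕ.⊔ L , λ n KLn → begin
    seq v n ℚ.- seq u n
      ≤⟨ ℚₚ.+-monoˡ-≤ (ℚ.- seq u n) (g n (ℕₚ.m⊔n≤o⇒m≤o K L KLn)) ⟩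
    q ℚ.+ c ℚ.+ ½ ℚ.* ε ℚ.- seq u n
      ≤⟨ ℚₚ.+-monoˡ-≤ (ℚ.- seq u n) (ℚₚ.+-monoˡ-≤ (½ ℚ.* ε) (ℚₚ.+-monoˡ-≤ c (h n (ℕₚ.m⊔n≤o⇒n≤o K L KLn)))) ⟩
    seq u n ℚ.+ ½ ℚ.* (½ ℚ.* ε) ℚ.+ ½ ℚ.* (½ ℚ.* ε) ℚ.+ c ℚ.+ ½ ℚ.* ε ℚ.- seq u n
      ≡⟨ solve 3 (λ u c e → u :+ con ½ :* (con ½ :* e) :+ con ½ :* (con ½ :* e) :+ c :+ con ½ :* e :- u := c :+ e)
           refl (seq u n) c ε ⟩
    c ℚ.+ ε ∎
  where open ℚₚ.≤-Reasoning

fromℚ-cancel-≤ : ∀ {p q} → fromℚ p ≤ fromℚ q → p ℚ.≤ q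
fromℚ-cancel-≤ {p} {q} p≤q = ℚₚ.≮⇒≥ λ q<p → <⇒≱ {fromℚ q} {fromℚ p}
  (mk< (p ℚ.- q , subst (ℚ._< p ℚ.- q) (ℚₚ.+-inverseʳ q) (ℚₚ.+-monoˡ-< (ℚ.- q) q<p) , 0
       , λ _ _ → ℚₚ.≤-reflexive (solve 2 (λ p q → q :+ (p :- q) := p) refl p q))) p≤q

-- Gaps between cyclically sorted points

insertAt-fromℕ-inject₁ : ∀ {n} (y : Vector ℝ n) v i → insertAt y (Fin.fromℕ n) v (inject₁ i) ≡ y i
insertAt-fromℕ-inject₁ {suc n} y v zero    = refl
insertAt-fromℕ-inject₁ {suc n} y v (suc i) = insertAt-fromℕ-inject₁ (λ j → y (suc j)) v i

module _ {n} {z y : Vector ℝ (suc n)} (S : IsSortedMod1 z y) where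
  open IsSortedMod1 S

  wrap-inject₁ : ∀ k → wrap y (inject₁ k) ≡ y k
  wrap-inject₁ = insertAt-fromℕ-inject₁ y (1ℝ + y zero)

  wrap-suc-≤-residue : ∀ k l → k Fin.< l → wrap y (suc k) ≤ y l
  -- Generalising the index lets `view` separate the appended point `1 + y zero`, whose position is
  -- too large to be at most `toℕ l`.
  wrap-suc-≤-residue k l k<l = go (suc k) k<l
    where
      go : ∀ (k′ : Fin (suc (suc n))) → toℕ k′ ℕ.≤ toℕ l → wrap y k′ ≤ y l
      go k′ h with view k′
      ... | ‵fromℕ = contradiction (Finₚ.toℕ<n l) (ℕₚ.≤⇒≯ (subst (ℕ._≤ toℕ l) (Finₚ.toℕ-fromℕ (suc n)) h))
      ... | ‵inj₁ {i = i} _ = subst (_≤ y l) (sym (wrap-inject₁ i))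
        (sorted i l (subst (ℕ._≤ toℕ l) (Finₚ.toℕ-inject₁ i) h))

  wrap-≤-last : ∀ k → wrap y k ≤ 1ℝ + y zero
  wrap-≤-last k with view k
  ... | ‵fromℕ = subst (_≤ 1ℝ + y zero) (sym (Vecₚ.insertAt-lookup y (Fin.fromℕ (suc n)) (1ℝ + y zero)))
                   (≤-refl {1ℝ + y zero})
  ... | ‵inj₁ {i = i} _ = subst (_≤ 1ℝ + y zero) (sym (wrap-inject₁ i))
    (≤-trans {y i} {1ℝ} {1ℝ + y zero} (<⇒≤ (upper i))
      (≤-trans {1ℝ} {1ℝ + 0ℝ} {1ℝ + y zero}
        (eventually-≤ {1ℝ} {1ℝ + 0ℝ} 0 λ _ _ → ℚₚ.≤-refl)
        (+-mono-≤ {1ℝ} {1ℝ} {0ℝ} {y zero} (≤-refl {1ℝ}) (lower zero))))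

  -- The alternative is decided by integers, not by comparing reals. Without a shift the positions
  -- `l` and `k` settle it by sortedness; a positive shift carries the point to `1 + y zero` or
  -- beyond, a negative one to 0 or below.
  no-point-in-gap : ∀ k l j → y l + fromℤ j ≤ wrap y (inject₁ k) ⊎ wrap y (suc k) ≤ y l + fromℤ j
  no-point-in-gap k l (+ 0) with toℕ l ℕₚ.≤? toℕ k
  ... | yes l≤k = inj₁ (subst (y l + 0ℝ ≤_) (sym (wrap-inject₁ k))
    (≤-trans {y l + 0ℝ} {y l} {y k}
      (eventually-≤ {y l + 0ℝ} {y l} 0 λ n _ → ℚₚ.≤-reflexive (ℚₚ.+-identityʳ (seq (y l) n))) (sorted l k l≤k)))
  ... | no l≰k = inj₂ (≤-trans {wrap y (suc k)} {y l} {y l + 0ℝ} (wrap-suc-≤-residue k l (ℕₚ.≰⇒> l≰k))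
      (eventually-≤ {y l} {y l + 0ℝ} 0 λ n _ → ℚₚ.≤-reflexive (sym (ℚₚ.+-identityʳ (seq (y l) n)))))
  no-point-in-gap k l +[1+ p ] = inj₂ (≤-trans {wrap y (suc k)} {1ℝ + y zero} {y l + fromℤ +[1+ p ]}
    (wrap-≤-last (suc k))
    (≤-trans {1ℝ + y zero} {y zero + 1ℝ} {y l + fromℤ +[1+ p ]}
      (eventually-≤ {1ℝ + y zero} {y zero + 1ℝ} 0 λ n _ → ℚₚ.≤-reflexive (ℚₚ.+-comm 1ℚ (seq (y zero) n)))
      (+-mono-≤ {y zero} {y l} {1ℝ} {fromℤ +[1+ p ]} (sorted zero l ℕ.z≤n)
        (eventually-≤ {1ℝ} {fromℤ +[1+ p ]} 0 λ _ _ → ⟦⟧-mono-≤ {+ 1} {+[1+ p ]} (ℤ.+≤+ (ℕ.s≤s ℕ.z≤n))))))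
  no-point-in-gap k l ℤ.-[1+ p ] = inj₁ (subst (y l + fromℤ ℤ.-[1+ p ] ≤_) (sym (wrap-inject₁ k))
    (≤-trans {y l + fromℤ ℤ.-[1+ p ]} {1ℝ + fromℤ (ℤ.- + 1)} {y k}
      (+-mono-≤ {y l} {1ℝ} {fromℤ ℤ.-[1+ p ]} {fromℤ (ℤ.- + 1)} (<⇒≤ (upper l))
        (eventually-≤ {fromℤ ℤ.-[1+ p ]} {fromℤ (ℤ.- + 1)} 0 λ _ _ → ⟦⟧-mono-≤ {ℤ.-[1+ p ]} {ℤ.- + 1} (ℤ.-≤- ℕ.z≤n)))
      (≤-trans {1ℝ + fromℤ (ℤ.- + 1)} {0ℝ} {y k}
        (eventually-≤ {1ℝ + fromℤ (ℤ.- + 1)} {0ℝ} 0 λ _ _ → ℚₚ.≤-refl) (lower k))))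

-- Grid arcs and the bound on the maximal gap

Meets : ∀ {N} → Vector ℝ N → ℚ → ℤ → Set
Meets z h i = ∃₂ λ l j → fromℚ (⟦ i ⟧ ℚ.* h) ≤ z l + fromℤ j × z l + fromℤ j ≤ fromℚ (⟦ i ⟧ ℚ.* h ℚ.+ h)

+ℤ-shift : ∀ x j k → x ℚ.+ ⟦ k ⟧ ℚ.+ ⟦ j ℤ.- k ⟧ ≡ x ℚ.+ ⟦ j ⟧
+ℤ-shift x j k = trans (cong (x ℚ.+ ⟦ k ⟧ ℚ.+_) (trans (⟦⟧-+ j (ℤ.- k)) (cong (⟦ j ⟧ ℚ.+_) (⟦⟧-neg k))))
  (solve 3 (λ x k j → x :+ k :+ (j :- k) := x :+ j) refl x ⟦ k ⟧ ⟦ j ⟧)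

≈₁-shift-≤ : ∀ {x y} k j → y ≃ x + fromℤ k →
  x + fromℤ j ≤ y + fromℤ (j ℤ.- k) × y + fromℤ (j ℤ.- k) ≤ x + fromℤ j
≈₁-shift-≤ {x} {y} k j y≃ =
    ≤-trans {x + fromℤ j} {x + fromℤ k + fromℤ (j ℤ.- k)} {y + fromℤ (j ℤ.- k)}
      (eventually-≤ 0 λ n _ → ℚₚ.≤-reflexive (sym (+ℤ-shift (seq x n) j k)))
      (+-mono-≤ (≃⇒≤ (≃-sym y≃)) ≤-refl)
  , ≤-trans {y + fromℤ (j ℤ.- k)} {x + fromℤ k + fromℤ (j ℤ.- k)} {x + fromℤ j}
      (+-mono-≤ (≃⇒≤ y≃) ≤-refl)
      (eventually-≤ 0 λ n _ → ℚₚ.≤-reflexive (+ℤ-shift (seq x n) j k))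

-- Sorting is undone by the inverse permutation, and the integer removed by reduction is absorbed
-- into the translate.
residues-meet : ∀ {N} {z y : Vector ℝ N} {h} → IsSortedMod1 z y → ∀ {i} → Meets z h i → Meets y h i
residues-meet {z = z} {y} {h} S {i} (l , j , below , above) =
  let k , y≃ = subst (λ m → y l′ ≈₁ z m) (inverseʳ reorder) (reduced l′)
      forth , back = ≈₁-shift-≤ {z l} {y l′} k j y≃
  in l′ , j ℤ.- k
   , ≤-trans {fromℚ (⟦ i ⟧ ℚ.* h)} {z l + fromℤ j} {y l′ + fromℤ (j ℤ.- k)} below forth
   , ≤-trans {y l′ + fromℤ (j ℤ.- k)} {z l + fromℤ j} {fromℚ (⟦ i ⟧ ℚ.* h ℚ.+ h)} back above
  where
    open IsSortedMod1 S
    l′ = reorder ⟨$⟩ˡ l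

fromℚ-mono-≤ : ∀ {p q} → p ℚ.≤ q → fromℚ p ≤ fromℚ q
fromℚ-mono-≤ {p} {q} p≤q = eventually-≤ {fromℚ p} {fromℚ q} 0 λ _ _ → p≤q

-- Rounding up to the grid costs at most one mesh `h`, and the arc that starts there has length `h`.
grid-above : ∀ M h → fromℕℚ M ℚ.* h ≡ 1ℚ → 0ℚ ℚ.≤ h →
  ∀ q → ∃ λ i → q ℚ.≤ ⟦ i ⟧ ℚ.* h × ⟦ i ⟧ ℚ.* h ℚ.+ h ℚ.≤ q ℚ.+ fromℕℚ 2 ℚ.* h
grid-above M h Mh≡1 0≤h q =
  let i , q≤i , i≤q+1 = round-up (q ℚ.* fromℕℚ M)
  in i , subst (ℚ._≤ ⟦ i ⟧ ℚ.* h) unscale (*-monoʳ-≤ 0≤h q≤i) , (begin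
    ⟦ i ⟧ ℚ.* h ℚ.+ h
      ≤⟨ ℚₚ.+-monoˡ-≤ h (*-monoʳ-≤ 0≤h i≤q+1) ⟩
    (q ℚ.* fromℕℚ M ℚ.+ 1ℚ) ℚ.* h ℚ.+ h
      ≡⟨ solve 2 (λ x h → (x :+ con 1ℚ) :* h :+ h := x :* h :+ con (fromℕℚ 2) :* h) refl (q ℚ.* fromℕℚ M) h ⟩
    q ℚ.* fromℕℚ M ℚ.* h ℚ.+ fromℕℚ 2 ℚ.* h
      ≡⟨ cong (ℚ._+ fromℕℚ 2 ℚ.* h) unscale ⟩
    q ℚ.+ fromℕℚ 2 ℚ.* h ∎)
  where
    open ℚₚ.≤-Reasoning
    unscale : q ℚ.* fromℕℚ M ℚ.* h ≡ q
    unscale = trans (ℚₚ.*-assoc q (fromℕℚ M) h) (trans (cong (q ℚ.*_) Mh≡1) (ℚₚ.*-identityʳ q))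

-- For a rational `q` beyond the left end of a gap, a whole grid arc fits between `q` and `q + 2h`,
-- and it contains a translate of a point. That translate is not at or before the left end, so the
-- right end comes no later than it.
maximalGap-≤ : ∀ {N} .{{_ : NonZero N}} (z : Vector ℝ N) {g} M h → fromℕℚ M ℚ.* h ≡ 1ℚ → 0ℚ ℚ.≤ h →
  (∀ i → Meets z h i) → IsMaximalGap z g → g ≤ fromℚ (fromℕℚ 2 ℚ.* h)
maximalGap-≤ {suc n} z {g} M h Mh≡1 0≤h meets G = ≤-trans {g} {largestGap y} {fromℚ (fromℕℚ 2 ℚ.* h)} (≃⇒≤ gap)
  (max-lub (λ k → wrap y (suc k) - wrap y (inject₁ k)) {fromℚ (fromℕℚ 2 ℚ.* h)}
    λ k → difference-≤ (wrap y (inject₁ k)) (wrap y (suc k)) (fromℕℚ 2 ℚ.* h) (next-point k))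
  where
    open IsMaximalGap G renaming (residues to y)

    next-point : ∀ k q → wrap y (inject₁ k) < fromℚ q → wrap y (suc k) ≤ fromℚ (q ℚ.+ fromℕℚ 2 ℚ.* h)
    next-point k q u<q =
      let i , q≤ih , ih+h≤ = grid-above M h Mh≡1 0≤h q
          l , j , below , above = residues-meet {z = z} {y} {h} isSorted {i} (meets i)
          p = y l + fromℤ j
      in case no-point-in-gap isSorted k l j of λ where
        (inj₁ p≤u) → contradiction
          (≤-trans {fromℚ q} {p} {wrap y (inject₁ k)}
            (≤-trans {fromℚ q} {fromℚ (⟦ i ⟧ ℚ.* h)} {p} (fromℚ-mono-≤ q≤ih) below) p≤u)
          (<⇒≱ {wrap y (inject₁ k)} {fromℚ q} u<q)
        (inj₂ v≤p) → ≤-trans {wrap y (suc k)} {p} {fromℚ (q ℚ.+ fromℕℚ 2 ℚ.* h)} v≤p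
          (≤-trans {p} {fromℚ (⟦ i ⟧ ℚ.* h ℚ.+ h)} {fromℚ (q ℚ.+ fromℕℚ 2 ℚ.* h)} above (fromℚ-mono-≤ ih+h≤))

-- Logarithms

harmonicBlock-++ : ∀ k c d → harmonicBlock k (c ℕ.+ d) ≡ harmonicBlock k c ℚ.+ harmonicBlock (c ℕ.+ k) d
harmonicBlock-++ k zero    d = sym (ℚₚ.+-identityˡ (harmonicBlock k d))
harmonicBlock-++ k (suc c) d = trans
  (cong (1/suc k ℚ.+_) (trans (harmonicBlock-++ (suc k) c d)
    (cong (λ j → harmonicBlock (suc k) c ℚ.+ harmonicBlock j d) (ℕₚ.+-suc c k))))
  (sym (ℚₚ.+-assoc (1/suc k) (harmonicBlock (suc k) c) (harmonicBlock (suc (c ℕ.+ k)) d)))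

harmonicBlock-≥ : ∀ w k c → (∀ i → i ℕ.< k ℕ.+ c → w ℚ.≤ 1/suc i) → fromℕℚ c ℚ.* w ℚ.≤ harmonicBlock k c
harmonicBlock-≥ w k zero    h = ℚₚ.≤-reflexive (ℚₚ.*-zeroˡ w)
harmonicBlock-≥ w k (suc c) h = begin
  fromℕℚ (suc c) ℚ.* w          ≡⟨ cong (ℚ._* w) (fromℕℚ-+ 1 c) ⟩
  (1ℚ ℚ.+ fromℕℚ c) ℚ.* w       ≡⟨ solve 2 (λ c w → (con 1ℚ :+ c) :* w := w :+ c :* w) refl (fromℕℚ c) w ⟩
  w ℚ.+ fromℕℚ c ℚ.* w          ≤⟨ ℚₚ.+-mono-≤ (h k (ℕₚ.m<m+n k (ℕ.s≤s ℕ.z≤n)))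
                                     (harmonicBlock-≥ w (suc k) c λ i i< → h i (subst (i ℕ.<_) (sym (ℕₚ.+-suc k c)) i<)) ⟩
  1/suc k ℚ.+ harmonicBlock (suc k) c ∎
  where open ℚₚ.≤-Reasoning

-- The `k` terms run from `1/(k+1)` to `1/(2k)`, and each is at least `1/(2k)`.
½≤harmonicBlock : ∀ k → .{{_ : NonZero k}} → ½ ℚ.≤ harmonicBlock k k
½≤harmonicBlock k@(suc k′) = subst (ℚ._≤ harmonicBlock k k) k*w≡½
  (harmonicBlock-≥ (recip (k ℕ.+ k)) k k λ i i< →
    ℚ.*≤* (ℤ.+≤+ (ℕₚ.+-monoˡ-≤ 0 i<)))
  where
    open ≡-Reasoning
    k*w≡½ : fromℕℚ k ℚ.* recip (k ℕ.+ k) ≡ ½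
    k*w≡½ = begin
      fromℕℚ k ℚ.* recip (k ℕ.+ k)
        ≡⟨ solve 2 (λ k w → k :* w := con ½ :* ((k :+ k) :* w)) refl (fromℕℚ k) (recip (k ℕ.+ k)) ⟩
      ½ ℚ.* ((fromℕℚ k ℚ.+ fromℕℚ k) ℚ.* recip (k ℕ.+ k))
        ≡⟨ cong (λ x → ½ ℚ.* (x ℚ.* recip (k ℕ.+ k))) (fromℕℚ-+ k k) ⟨
      ½ ℚ.* (fromℕℚ (k ℕ.+ k) ℚ.* recip (k ℕ.+ k))
        ≡⟨ cong (½ ℚ.*_) (fromℕℚ*recip (k ℕ.+ k)) ⟩
      ½ ∎

-- Oresme's grouping: between `k` and `k * 2^t` there are `t` doublings, each contributing at least
-- `½`. Surplus terms are nonnegative.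
harmonicBlock-dyadic : ∀ t k c → .{{_ : NonZero k}} → k ℕ.* 2 ℕ.^ t ℕ.≤ k ℕ.+ c →
  fromℕℚ t ℚ.* ½ ℚ.≤ harmonicBlock k c
harmonicBlock-dyadic zero    k c h = ℚₚ.≤-trans (ℚₚ.≤-reflexive (sym (ℚₚ.*-zeroʳ (fromℕℚ c)))) (harmonicBlock-≥ 0ℚ k c λ i _ → ℚₚ.nonNegative⁻¹ (1/suc i))
harmonicBlock-dyadic (suc t) k c h = begin
  fromℕℚ (suc t) ℚ.* ½
    ≡⟨ trans (cong (ℚ._* ½) (fromℕℚ-+ 1 t)) (solve 1 (λ t → (con 1ℚ :+ t) :* con ½ := con ½ :+ t :* con ½) refl (fromℕℚ t)) ⟩
  ½ ℚ.+ fromℕℚ t ℚ.* ½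
    ≤⟨ ℚₚ.+-mono-≤ (½≤harmonicBlock k) (harmonicBlock-dyadic t (k ℕ.+ k) d {{ℕ.>-nonZero (ℕₚ.≤-trans (ℕ.>-nonZero⁻¹ k) (ℕₚ.m≤m+n k k))}} rest) ⟩
  harmonicBlock k k ℚ.+ harmonicBlock (k ℕ.+ k) d
    ≡⟨ harmonicBlock-++ k k d ⟨
  harmonicBlock k (k ℕ.+ d)
    ≡⟨ cong (harmonicBlock k) (ℕₚ.m+[n∸m]≡n k≤c) ⟩
  harmonicBlock k c ∎
  where
    open ℚₚ.≤-Reasoning
    d = c ℕ.∸ k
    double : ∀ k x → (k ℕ.+ k) ℕ.* x ≡ k ℕ.* (2 ℕ.* x)
    double = solve-∀
    k≤c : k ℕ.≤ c
    k≤c = ℕₚ.+-cancelˡ-≤ k k c (ℕₚ.≤-trans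
      (ℕₚ.m≤m*n (k ℕ.+ k) (2 ℕ.^ t) {{ℕₚ.m^n≢0 2 t}})
      (ℕₚ.≤-trans (ℕₚ.≤-reflexive (double k (2 ℕ.^ t))) h))
    rest : (k ℕ.+ k) ℕ.* 2 ℕ.^ t ℕ.≤ k ℕ.+ k ℕ.+ d
    rest = subst₂ ℕ._≤_ (sym (double k (2 ℕ.^ t)))
      (trans (cong (k ℕ.+_) (sym (ℕₚ.m+[n∸m]≡n k≤c))) (sym (ℕₚ.+-assoc k k d))) h

-- The denominators run from just above `suc m` to `N * suc m`, a ratio of `N` at every mesh, so the
-- bound holds for each approximation of `log N`.
logSum-≥ : ∀ t N m → .{{_ : NonZero N}} → 2 ℕ.^ t ℕ.≤ N → fromℕℚ t ℚ.* ½ ℚ.≤ logSum N m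
logSum-≥ t (suc N) m h = harmonicBlock-dyadic t (suc m) (N ℕ.* suc m)
  (ℕₚ.≤-trans (ℕₚ.*-monoʳ-≤ (suc m) h) (ℕₚ.≤-reflexive (ℕₚ.*-comm (suc m) (suc N))))

-- Lacunarity over the integers and the final estimate

rational-growth : ∀ d x y → fromℚ ((1ℚ ℚ.+ 1/suc d) ℚ.* fromℕℚ x) ≤ fromℕ y → suc (suc d) ℕ.* x ℕ.≤ suc d ℕ.* y
rational-growth d x y h = ℤₚ.drop‿+≤+ (⟦⟧-cancel-≤ (begin
  fromℕℚ (suc (suc d) ℕ.* x)
    ≡⟨ trans (fromℕℚ-* (suc (suc d)) x) (cong (ℚ._* fromℕℚ x) (fromℕℚ-+ 1 (suc d))) ⟩
  (1ℚ ℚ.+ fromℕℚ (suc d)) ℚ.* fromℕℚ x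
    ≡⟨ cong (λ w → (w ℚ.+ fromℕℚ (suc d)) ℚ.* fromℕℚ x) (fromℕℚ*recip (suc d)) ⟨
  (fromℕℚ (suc d) ℚ.* 1/suc d ℚ.+ fromℕℚ (suc d)) ℚ.* fromℕℚ x
    ≡⟨ solve 3 (λ D e x → (D :* e :+ D) :* x := D :* ((con 1ℚ :+ e) :* x)) refl (fromℕℚ (suc d)) (1/suc d) (fromℕℚ x) ⟩
  fromℕℚ (suc d) ℚ.* ((1ℚ ℚ.+ 1/suc d) ℚ.* fromℕℚ x)
    ≤⟨ *-monoˡ-≤ (0≤fromℕℚ (suc d)) (fromℚ-cancel-≤ h) ⟩
  fromℕℚ (suc d) ℚ.* fromℕℚ y
    ≡⟨ fromℕℚ-* (suc d) y ⟨
  fromℕℚ (suc d ℕ.* y) ∎))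
  where open ℚₚ.≤-Reasoning

-- The constant arises from `N * 2 * ½^s ≤ 8 * D * (s+2) ≤ 16 * D * (s+1)`, which is `32 *
-- D` times the lower bound `(s+1)/2` of `Λ`.
mesh-≤ : ∀ D s N Λ → .{{_ : NonZero N}} → N ℕ.≤ D ℕ.* (2 ℕ.^ suc (suc s) ℕ.* suc (suc s)) →
  fromℕℚ (suc s) ℚ.* ½ ℚ.≤ Λ → fromℕℚ 2 ℚ.* ½^ s ℚ.≤ fromℕℚ (32 ℕ.* D) ℚ.* (Λ ℚ.* (+ 1 ℚ./ N))
mesh-≤ D s N Λ N≤ Λ≥ = begin
  2h
    ≡⟨ trans (sym (ℚₚ.*-identityʳ 2h)) (cong (2h ℚ.*_) (sym (fromℕℚ*recip N))) ⟩
  2h ℚ.* (fromℕℚ N ℚ.* recip N)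
    ≡⟨ solve 3 (λ h n r → h :* (n :* r) := n :* h :* r) refl 2h (fromℕℚ N) (recip N) ⟩
  fromℕℚ N ℚ.* 2h ℚ.* recip N
    ≤⟨ *-monoʳ-≤ (0≤recip N) N*2h≤ ⟩
  fromℕℚ (32 ℕ.* D) ℚ.* Λ ℚ.* recip N
    ≡⟨ ℚₚ.*-assoc (fromℕℚ (32 ℕ.* D)) Λ (recip N) ⟩
  fromℕℚ (32 ℕ.* D) ℚ.* (Λ ℚ.* recip N)
    ≡⟨ cong (λ w → fromℕℚ (32 ℕ.* D) ℚ.* (Λ ℚ.* w)) (1/≡recip N) ⟨
  fromℕℚ (32 ℕ.* D) ℚ.* (Λ ℚ.* (+ 1 ℚ./ N)) ∎
  where
    open ℚₚ.≤-Reasoning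
    2h = fromℕℚ 2 ℚ.* ½^ s
    M = 2 ℕ.^ suc (suc s)
    2+s≤2*[1+s] : suc (suc s) ℕ.≤ 2 ℕ.* suc s
    2+s≤2*[1+s] = subst (suc (suc s) ℕ.≤_) (double s) (ℕₚ.m≤m+n (suc (suc s)) s)
      where
        double : ∀ s → 2 ℕ.+ s ℕ.+ s ≡ 2 ℕ.* (1 ℕ.+ s)
        double = solve-∀
    N*2h≤ : fromℕℚ N ℚ.* 2h ℚ.≤ fromℕℚ (32 ℕ.* D) ℚ.* Λ
    N*2h≤ = begin
      fromℕℚ N ℚ.* 2h
        ≤⟨ *-monoʳ-≤ (subst (ℚ._≤ 2h) (ℚₚ.*-zeroʳ (fromℕℚ 2)) (*-monoˡ-≤ (0≤fromℕℚ 2) (0≤½^ s)))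
             (fromℕℚ-mono-≤ N≤) ⟩
      fromℕℚ (D ℕ.* (M ℕ.* suc (suc s))) ℚ.* 2h
        ≡⟨ cong (ℚ._* 2h) (trans (fromℕℚ-* D (M ℕ.* suc (suc s))) (cong (fromℕℚ D ℚ.*_) (fromℕℚ-* M (suc (suc s))))) ⟩
      fromℕℚ D ℚ.* (fromℕℚ M ℚ.* fromℕℚ (suc (suc s))) ℚ.* 2h
        ≡⟨ solve 4 (λ D M t h → D :* (M :* t) :* (con (fromℕℚ 2) :* h)
                             := con (fromℕℚ 8) :* D :* t :* (M :* (con ½ :* (con ½ :* h))))
             refl (fromℕℚ D) (fromℕℚ M) (fromℕℚ (suc (suc s))) (½^ s) ⟩
      fromℕℚ 8 ℚ.* fromℕℚ D ℚ.* fromℕℚ (suc (suc s)) ℚ.* (fromℕℚ M ℚ.* ½^ suc (suc s))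
        ≡⟨ trans (cong (fromℕℚ 8 ℚ.* fromℕℚ D ℚ.* fromℕℚ (suc (suc s)) ℚ.*_) (2^*½^ (suc (suc s)))) (ℚₚ.*-identityʳ _) ⟩
      fromℕℚ 8 ℚ.* fromℕℚ D ℚ.* fromℕℚ (suc (suc s))
        ≡⟨ cong (ℚ._* fromℕℚ (suc (suc s))) (fromℕℚ-* 8 D) ⟨
      fromℕℚ (8 ℕ.* D) ℚ.* fromℕℚ (suc (suc s))
        ≤⟨ *-monoˡ-≤ (0≤fromℕℚ (8 ℕ.* D)) (fromℕℚ-mono-≤ 2+s≤2*[1+s]) ⟩
      fromℕℚ (8 ℕ.* D) ℚ.* fromℕℚ (2 ℕ.* suc s)
        ≡⟨ cong₂ ℚ._*_ (fromℕℚ-* 8 D) (fromℕℚ-* 2 (suc s)) ⟩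
      (fromℕℚ 8 ℚ.* fromℕℚ D) ℚ.* (fromℕℚ 2 ℚ.* fromℕℚ (suc s))
        ≡⟨ solve 2 (λ D t → (con (fromℕℚ 8) :* D) :* (con (fromℕℚ 2) :* t)
                         := (con (fromℕℚ 32) :* D) :* (t :* con ½)) refl (fromℕℚ D) (fromℕℚ (suc s)) ⟩
      (fromℕℚ 32 ℚ.* fromℕℚ D) ℚ.* (fromℕℚ (suc s) ℚ.* ½)
        ≡⟨ cong (ℚ._* (fromℕℚ (suc s) ℚ.* ½)) (fromℕℚ-* 32 D) ⟨
      fromℕℚ (32 ℕ.* D) ℚ.* (fromℕℚ (suc s) ℚ.* ½)
        ≤⟨ *-monoˡ-≤ (0≤fromℕℚ (32 ℕ.* D)) Λ≥ ⟩
      fromℕℚ (32 ℕ.* D) ℚ.* Λ ∎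

module _ (a : ℕ → ℕ) (D : ℕ) {{D-nz : NonZero D}} {{a-nz : ∀ {n} → NonZero (a n)}}
         (a-mono : ∀ n → a n ℕ.≤ a (suc n))
         (growth : ∀ n → suc D ℕ.* a n ℕ.≤ D ℕ.* a (suc n)) where
  open Schedule a D a-mono growth

  points : ∀ N → Vector ℝ N
  points N i = α * fromℕ (a (toℕ i))

  points-meet : ∀ s N → stage s ℕ.≤ N → ∀ i → Meets (points N) (½^ s) i
  points-meet s N stage≤N i =
    let n , j , n<stage , K , near = hit s i
        l = Fin.fromℕ< (ℕₚ.<-≤-trans n<stage stage≤N)
        near′ = subst (λ n → ∀ k → K ℕ.≤ k →
                  ⟦ i ⟧ ℚ.* ½^ s ℚ.≤ approx k ℚ.* fromℕℚ (a n) ℚ.+ ⟦ j ⟧ ×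
                  approx k ℚ.* fromℕℚ (a n) ℚ.+ ⟦ j ⟧ ℚ.≤ ⟦ i ⟧ ℚ.* ½^ s ℚ.+ ½^ s)
                (sym (Finₚ.toℕ-fromℕ< (ℕₚ.<-≤-trans n<stage stage≤N))) near
    in l , j
     , eventually-≤ {fromℚ (⟦ i ⟧ ℚ.* ½^ s)} {points N l + fromℤ j} K (λ k h → proj₁ (near′ k h))
     , eventually-≤ {points N l + fromℤ j} {fromℚ (⟦ i ⟧ ℚ.* ½^ s ℚ.+ ½^ s)} K (λ k h → proj₂ (near′ k h))

  -- With `N` between `stage s` and `stage (s+1)`, the lower end guarantees the full grid of mesh
  -- `½^s` and, through `2^(s+1) ≤ N`, the bound on `log N`; the upper end limits `N` itself.
  gap-bound : ∀ N → .{{_ : NonZero N}} → stage 0 ℕ.≤ N → ∀ g → IsMaximalGap (points N) g →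
    g ≤ fromℕ (32 ℕ.* D) * (log N /ℕ N)
  gap-bound N stage≤N g G =
    let s , lo , hi = level-exists stage stage-unbounded N stage≤N
    in ≤-trans {g} {fromℚ (fromℕℚ 2 ℚ.* ½^ s)} {fromℕ (32 ℕ.* D) * (log N /ℕ N)}
      (maximalGap-≤ (points N) {g} (2 ℕ.^ s) (½^ s) (2^*½^ s) (0≤½^ s) (points-meet s N lo) G)
      (eventually-≤ {fromℚ (fromℕℚ 2 ℚ.* ½^ s)} {fromℕ (32 ℕ.* D) * (log N /ℕ N)} 0 λ k _ →
        mesh-≤ D s N (logSum N k) (ℕₚ.<⇒≤ hi) (logSum-≥ (suc s) N k (ℕₚ.≤-trans (2^suc≤stage s) lo)))

0<fromℕ : ∀ n → .{{_ : NonZero n}} → 0ℝ < fromℕ n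
0<fromℕ (suc n) = mk< (1ℚ , ℚₚ.positive⁻¹ 1ℚ , 0 , λ _ _ →
  ℚₚ.≤-trans (ℚₚ.≤-reflexive (ℚₚ.+-identityˡ 1ℚ)) (⟦⟧-mono-≤ {+ 1} {+ suc n} (ℤ.+≤+ (ℕ.s≤s ℕ.z≤n))))

-- The real factor `r` is lowered to the rational `1 + 1/suc d`, after which denominators can be
-- cleared.
lacunary⇒rational-growth : ∀ r {ε K} d → 1/suc d ℚ.≤ ε → (∀ n → K ℕ.≤ n → 1ℚ ℚ.+ ε ℚ.≤ seq r n) →
  ∀ x y → r * fromℕ x ≤ fromℕ y → suc (suc d) ℕ.* x ℕ.≤ suc d ℕ.* y
lacunary⇒rational-growth r {K = K} d 1/D≤ε 1+ε≤r x y rx≤y = rational-growth d x y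
  (≤-trans {fromℚ ((1ℚ ℚ.+ 1/suc d) ℚ.* fromℕℚ x)} {r * fromℕ x} {fromℕ y}
    (eventually-≤ {fromℚ ((1ℚ ℚ.+ 1/suc d) ℚ.* fromℕℚ x)} {r * fromℕ x} K λ n h →
      *-monoʳ-≤ (0≤fromℕℚ x) (ℚₚ.≤-trans (ℚₚ.+-monoʳ-≤ 1ℚ 1/D≤ε) (1+ε≤r n h)))
    rx≤y)

theorem2p2 : (r : ℝ) → 1ℝ < r →
    Σ[ C ∈ ℝ ] (0ℝ < C) × (
    (a : ℕ → ℕ) →
    (∀ n → 0 ℕ.< a n) →
    (∀ n → a n ℕ.< a (suc n)) →
    (∀ n → r * fromℕ (a n) ≤ fromℕ (a (suc n))) →
    Σ[ α ∈ ℝ ] Σ[ N₀ ∈ ℕ ]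
    ((N : ℕ) → .{{_ : NonZero N}} → N₀ ℕ.≤ N →
    (g : ℝ) → IsMaximalGap (λ (i : Fin N) → α * fromℕ (a (toℕ i))) g →
    g ≤ C * (log N /ℕ N)))
theorem2p2 r (mk< (ε , ε>0 , K , 1+ε≤r)) =
  let d , 1/D≤ε = archimedean ε ε>0
      D = suc d
  -- `D` comes from the margin in `1 < r` alone and is fixed before the sequence is given, so the
  -- constant serves all sequences.
  in fromℕ (32 ℕ.* D) , 0<fromℕ (32 ℕ.* D) , λ a a>0 a-increasing lacunary →
    let a-nz : ∀ {n} → NonZero (a n)
        a-nz {n} = ℕ.>-nonZero (a>0 n)
        a-mono : ∀ n → a n ℕ.≤ a (suc n)
        a-mono n = ℕₚ.<⇒≤ (a-increasing n)
        growth : ∀ n → suc D ℕ.* a n ℕ.≤ D ℕ.* a (suc n)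
        growth n = lacunary⇒rational-growth r {ε} {K} d 1/D≤ε 1+ε≤r (a n) (a (suc n)) (lacunary n)
    in Schedule.α a D {{_}} {{a-nz}} a-mono growth
     -- The threshold is `2 * D`, by which the first stage is complete.
     , Schedule.stage a D {{_}} {{a-nz}} a-mono growth 0
     , gap-bound a D {{_}} {{a-nz}} a-mono growth
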